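{- Let $k,d,\ell$ be integers with $1\le d\le k-1$ and $0\le \ell\le k-1$. Then: (i) if $d\le \ell+1$ then $g(k,d,\ell)\le \frac{1}{d+1}$, and if $d\ge \ell+1$ then $g(k,d,\ell)\le \frac{1}{\ell+2}$; (ii) if $d>1$ then $\left\lfloor \frac{2^{k-d}}{3}\right\rfloor 2^{d-k}\le g(k,d,1)<\frac13$.
   Context: A $k$-graph $H$ is a $k$-uniform hypergraph: a finite vertex set $V(H)$ with edge set $E(H)\subseteq\binom{V(H)}{k}$. For $1\le d\le k-1$, $\deg_H(S)$ is the number of edges containing a $d$-set $S\subseteq V(H)$, and $\delta_d(H)=\min\deg_H(S)$ over all $d$-subsets $S$ of $V(H)$. Construction: let $0\le \ell\le k-1$, $j\in\{0,1,\dots,\ell+1\}$, $n\equiv \ell \pmod k$, and let $x\in[0,1]$ be a real number such that $xn$ is an integer with $xn\equiv \lfloor n/k\rfloor j+\ell+1 \pmod{\ell+2}$. Let $V$ be an $n$-set with a partition $V=V_1\cup V_2$, $|V_1|=xn$. $H_\ell^j(x)$ is the $k$-graph on $V$ whose edges are all $k$-sets $e$ with $|e\cap V_1|\equiv j \pmod{\ell+2}$. Define $$g(k,d,\ell):=\lim_{n\to\infty}\left(\max_{0\le j\le \ell+1}\max_{x}\ \delta_d(H_\ell^j(x))\Big/\binom{n-d}{k-d}\right),$$ where $n$ runs over integers $n\equiv \ell\pmod k$ and $x$ over the admissible values in $[0,1]$. -}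

module Defs where

open import Data.Fin using (toℕ)
open import Data.Fin.Subset using (Subset; inside; outside; ∣_∣; _∩_; _⊆_)
open import Data.Fin.Subset.Properties using (_⊆?_)
open import Data.Integer using (+_)
open import Data.List using (List; []; _∷_; _++_; map; filter; length; upTo)
open import Data.List.Extrema.Nat using (min; max)
open import Data.Nat as ℕ using (ℕ; zero; suc; _≟_; _<?_; NonZero)
open import Data.Nat.Combinatorics using (_C_)
open import Data.Nat.Properties using (m^n≢0)
open import Data.Product using (_×_; ∃-syntax; proj₁)
open import Data.Rational as ℚ using (ℚ; 0ℚ)
open import Data.Vec using ([]; _∷_; tabulate)
open import Relation.Binary.PropositionalEquality using (_≡_)
open import Relation.Nullary using (Dec; does)
open import Relation.Nullary.Decidable using (_×-dec_)

-- Real numbers, as Cauchy sequences of rationals.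

record ℝ : Set where
  field
    approx : ℕ → ℚ
    cauchy : ∀ ε → 0ℚ ℚ.< ε → ∃[ N ] (∀ m n → N ℕ.≤ m → N ℕ.≤ n →
               ℚ.∣ approx m ℚ.- approx n ∣ ℚ.≤ ε)

open ℝ public

infix 4 _≤ᴿ_ _<ᴿ_

_≤ᴿ_ : ℝ → ℝ → Set
x ≤ᴿ y = ∀ ε → 0ℚ ℚ.< ε → ∃[ N ] (∀ n → N ℕ.≤ n →
           approx x n ℚ.≤ approx y n ℚ.+ ε)

_<ᴿ_ : ℝ → ℝ → Set
x <ᴿ y = ∃[ ε ] (0ℚ ℚ.< ε × ∃[ N ] (∀ n → N ℕ.≤ n →
           approx x n ℚ.+ ε ℚ.≤ approx y n))

fromℚ : ℚ → ℝ
fromℚ q = record { approx = λ _ → q ; cauchy = λ ε 0<ε → 0 , λ _ _ _ _ → within 0<ε }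
  where
  open import Data.Product using (_,_)
  open import Data.Rational.Properties using (+-inverseʳ; <⇒≤)
  open import Relation.Binary.PropositionalEquality using (sym; subst; cong)
  within : ∀ {ε} → 0ℚ ℚ.< ε → ℚ.∣ q ℚ.- q ∣ ℚ.≤ ε
  within {ε} 0<ε = subst (ℚ._≤ ε) (cong ℚ.∣_∣ (sym (+-inverseʳ q))) (<⇒≤ 0<ε)

-- The limit of a n as n → ∞ through those n satisfying P is x; the two
-- inequalities say |a n - x| ≤ ε.
LimitAlong : (P : ℕ → Set) → (ℕ → ℚ) → ℝ → Set
LimitAlong P a x = ∀ ε → 0ℚ ℚ.< ε → ∃[ N ] (∀ n → N ℕ.≤ n → P n →
  fromℚ (a n ℚ.- ε) ≤ᴿ x × x ≤ᴿ fromℚ (a n ℚ.+ ε))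

-- k-graphs on the vertex set Fin n.
record UniformHypergraph (k n : ℕ) : Set₁ where
  field
    Edge    : Subset n → Set
    edge?   : ∀ e → Dec (Edge e)
    uniform : ∀ {e} → Edge e → ∣ e ∣ ≡ k

open UniformHypergraph public

subsets : ∀ n → List (Subset n)
subsets zero    = [] ∷ []
subsets (suc n) = map (outside ∷_) (subsets n) ++ map (inside ∷_) (subsets n)

-- Minimum and maximum of a list, with value 0 on the empty list.
minimum : List ℕ → ℕ
minimum []       = 0
minimum (x ∷ xs) = min x xs

maximum : List ℕ → ℕ
maximum []       = 0
maximum (x ∷ xs) = max x xs

deg : ∀ {k n} → UniformHypergraph k n → Subset n → ℕ
deg {n = n} H S = length (filter (λ e → edge? H e ×-dec (S ⊆? e)) (subsets n))

δ : ∀ {k n} → ℕ → UniformHypergraph k n → ℕ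
δ {n = n} d H = minimum (map (deg H) (filter (λ S → ∣ S ∣ ≟ d) (subsets n)))

infix 4 _≋_[mod_] _≋?_[mod_]

_≋_[mod_] : ℕ → ℕ → (m : ℕ) → .{{NonZero m}} → Set
a ≋ b [mod m ] = a ℕ.% m ≡ b ℕ.% m

_≋?_[mod_] : ∀ a b m → .{{_ : NonZero m}} → Dec (a ≋ b [mod m ])
a ≋? b [mod m ] = a ℕ.% m ≟ b ℕ.% m

-- The construction for a partition V = V₁ ∪ V₂ of V = Fin n, V₂ being the
-- complement of V₁.
congruenceGraph : ∀ {n} (k ℓ j : ℕ) → Subset n → UniformHypergraph k n
congruenceGraph k ℓ j V₁ = record
  { Edge    = λ e → ∣ e ∣ ≡ k × ∣ e ∩ V₁ ∣ ≋ j [mod 2 ℕ.+ ℓ ]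
  ; edge?   = λ e → (∣ e ∣ ≟ k) ×-dec (∣ e ∩ V₁ ∣ ≋? j [mod 2 ℕ.+ ℓ ])
  ; uniform = proj₁
  }

initialSegment : ∀ {n} → ℕ → Subset n
initialSegment s = tabulate (λ i → does (toℕ i <? s))

-- H_ℓ^j(x) is parametrised by the integer s = xn, 0 ≤ s ≤ n, instead of x. It
-- is determined up to isomorphism by s, and V₁ is taken to be the first s
-- vertices.
H : (n k ℓ j s : ℕ) → UniformHypergraph k n
H n k ℓ j s = congruenceGraph k ℓ j (initialSegment s)

admissible : (n k ℓ j : ℕ) → .{{NonZero k}} → List ℕ
admissible n k ℓ j =
  filter (λ s → s ≋? (n ℕ./ k) ℕ.* j ℕ.+ ℓ ℕ.+ 1 [mod 2 ℕ.+ ℓ ]) (upTo (suc n))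

maxδ : (k d ℓ n : ℕ) → .{{NonZero k}} → ℕ
maxδ k d ℓ n =
  maximum (map (λ j → maximum (map (λ s → δ d (H n k ℓ j s)) (admissible n k ℓ j)))
               (upTo (2 ℕ.+ ℓ)))

-- The quotient a / b, with value 0 when b = 0.
ratio : ℕ → ℕ → ℚ
ratio a zero    = 0ℚ
ratio a (suc b) = + a ℚ./ suc b

-- For d < k the denominator vanishes only when n < k, which does not affect
-- the limit.
density : (k d ℓ : ℕ) → .{{NonZero k}} → ℕ → ℚ
density k d ℓ n = ratio (maxδ k d ℓ n) ((n ℕ.∸ d) C (k ℕ.∸ d))

-- g(k,d,ℓ) = x, the defining limit being over n ≡ ℓ (mod k).
g[_,_,_]≐_ : (k d ℓ : ℕ) → .{{NonZero k}} → ℝ → Set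
g[ k , d , ℓ ]≐ x = LimitAlong (λ n → n ≋ ℓ [mod k ]) (density k d ℓ) x

infix 8 2^-_

2^-_ : ℕ → ℚ
2^- m = (+ 1 ℚ./ (2 ℕ.^ m)) {{m^n≢0 2 m}}

{-# OPTIONS --safe #-}
module Submission where

-- Write r = k - d. The degree of a d-set S depends only on i = |S ∩ V₁|: up to
-- an error O(n^(r-1)) it is the number of r-subsets f of V with
-- |f ∩ V₁| + i ≡ j modulo ℓ + 2. For (i), the classes belonging to distinct
-- residues i are disjoint, so the smallest has at most its share of all r-subsets.
-- For (ii) the modulus is 3. Let p₀, p₁, p₂ count the r-tuples by residue; then
-- p₀ + p₁ω + p₂ω² is, up to a unit, (b + aω)^r with a = |V₁|, b = |V₂|, whose norm
-- (a² - ab + b²)^r is at least ((a + b)²/4)^r. So the pᵢ cannot all be nearly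
-- equal, uniformly in a and b, which gives the strict bound. For the lower bound
-- take |V₁| ≈ |V₂| and pair the two sides up: almost every r-subset is a
-- transversal of r pairs, and of the 2^r transversals of given pairs each residue
-- class contains at least ⌊2^r/3⌋.

open import Defs
open import Data.Bool using (true; false)
open import Data.Fin.Subset using (Subset; inside; outside; ∣_∣; _∩_; ∁; _⊆_)
open import Data.Fin.Subset.Properties using (_⊆?_; p⊆q⇒∣p∣≤∣q∣; ∣p∩q∣≤∣p∣; ∣∁p∣≡n∸∣p∣; out⊆; in⊆in; drop-∷-⊆)
open import Data.Integer using (+_)
import Data.Integer as ℤ
import Data.Integer.Properties as ℤ
open import Data.List using (List; []; _∷_; _++_; map; filter; length; upTo)
open import Data.List.Extrema.Nat using (min≤⊤; min≤xs; v≤min⁺; ⊥≤max; xs≤max; argmax-all)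
open import Data.List.Membership.Propositional using (_∈_)
open import Data.List.Membership.Propositional.Properties
  using (∈-filter⁺; ∈-filter⁻; ∈-map⁺; ∈-map⁻; ∈-++⁺ˡ; ∈-++⁺ʳ; ∈-upTo⁺; ∈-upTo⁻)
open import Data.List.Properties using (filter-++; length-++)
import Data.List.Relation.Unary.All as All
open import Data.List.Relation.Unary.All.Properties using (map⁺)
open import Data.List.Relation.Unary.Any using (here; there)
open import Data.Nat hiding (_/_)
open import Data.Nat as ℕ using ()
open import Data.Nat.Combinatorics using (_C_; nC1≡n; nCk+nC[k+1]≡[n+1]C[k+1])
open import Data.Nat.Coprimality using (Coprime)
open import Data.Nat.Divisibility using (divides; ∣m+n∣m⇒∣n; >⇒∤)
open import Data.Nat.DivMod hiding (_/_)
open import Data.Nat.Properties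
open import Data.Nat.Tactic.RingSolver using (solve-∀)
open import Data.Product using (_×_; _,_; proj₁; proj₂; ∃-syntax)
open import Data.Rational using (_/_)
open import Data.Rational as ℚ using (ℚ; 0ℚ; ½; mkℚ; toℚᵘ; *<*)
import Data.Rational.Properties as ℚ
import Data.Rational.Unnormalised as ℚᵘ
open ℚᵘ using (mkℚᵘ)
import Data.Rational.Unnormalised.Properties as ℚᵘ
open import Data.Sum using (_⊎_; inj₁; inj₂)
open import Data.Vec as Vec using ([]; _∷_)
open import Function using (_∘_; id; case_of_)
open import Level using (0ℓ)
open import Relation.Binary.PropositionalEquality hiding ([_])
import Relation.Binary.Reasoning.Setoid as SetoidReasoning
open import Relation.Nullary
open import Relation.Nullary.Decidable using (_×-dec_)
open import Relation.Unary using (Pred; Decidable)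

-- The averaging needs d-sets that meet V₁ in each of 0, 1, ..., e vertices, hence enough vertices
-- on both sides. If one side has fewer than `d` vertices, nearly all extensions of S stay on the
-- other side, the residue is constant, and the graph could be almost complete through every d-set.
-- The congruence on xn, combined with n ≡ ℓ modulo k, excludes this when V₁ is empty or all of V; a
-- side that is small but non-empty offers two consecutive values of i, one of which is wrong. The
-- strict bound needs a gap independent of a and b: the excess of the three counts over three times
-- the least is at least ((a + b)/2)^r, so the least is at most (1 - 2^-r)/3 of all tuples.
-- Existence of the limit is not at issue: the claims concern any real that is the limit. Each
-- becomes an inequality between `maxδ` and C(n - d, k - d) with an error of lower order, tested,
-- for each ε, at one large n.

infix 3 _≤1

_≤1 : (ℕ → ℕ) → Set
w ≤1 = ∀ t → w t ≤ 1

-- Estimates for binomial coefficients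

pascal : ∀ n k → suc n C suc k ≡ n C suc k + n C k
pascal n k = trans (sym (nCk+nC[k+1]≡[n+1]C[k+1] n k)) (+-comm (n C k) (n C suc k))

C-suc-mono : ∀ n r → n C r ≤ suc n C r
C-suc-mono n zero    = ≤-refl
C-suc-mono n (suc r) = ≤-trans (m≤m+n _ _) (≤-reflexive (sym (pascal n r)))

C-+-mono : ∀ c n r → n C r ≤ (c + n) C r
C-+-mono zero    n r = ≤-refl
C-+-mono (suc c) n r = ≤-trans (C-+-mono c n r) (C-suc-mono (c + n) r)

C-mono : ∀ {m n} r → m ≤ n → m C r ≤ n C r
C-mono {m} {n} r m≤n = subst (λ x → m C r ≤ x C r) (m∸n+n≡m m≤n) (C-+-mono (n ∸ m) m r)

-- Each of the `c` extra points, added one at a time, creates at most `(c + n) C r` new subsets.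
C-+-error : ∀ c n r → (c + n) C suc r ≤ n C suc r + c * ((c + n) C r)
C-+-error zero    n r = m≤m+n _ _
C-+-error (suc c) n r = begin
  suc (c + n) C suc r                                   ≡⟨ pascal (c + n) r ⟩
  (c + n) C suc r + (c + n) C r                         ≤⟨ +-monoˡ-≤ _ (C-+-error c n r) ⟩
  n C suc r + c * ((c + n) C r) + (c + n) C r           ≡⟨ rearrange (n C suc r) c ((c + n) C r) ⟩
  n C suc r + suc c * ((c + n) C r)                     ≤⟨ +-monoʳ-≤ (n C suc r) (*-monoʳ-≤ (suc c) (C-suc-mono (c + n) r)) ⟩
  n C suc r + suc c * (suc (c + n) C r)                 ∎
  where
  open ≤-Reasoning
  rearrange : ∀ x c y → x + c * y + y ≡ x + (1 + c) * y
  rearrange = solve-∀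

-- Both sides count pairs of a k-subset and a point: a point outside it gives a (k + 1)-subset with
-- a marked element, a point inside it one of `k` choices.
absorption : ∀ n k → n * (n C k) ≡ suc k * (n C suc k) + k * (n C k)
absorption zero    zero    = refl
absorption zero    (suc k) = sym (cong₂ _+_ (*-zeroʳ (2 + k)) (*-zeroʳ (suc k)))
absorption (suc n) zero    = begin
  suc n * 1                              ≡⟨ cong suc (absorption n zero) ⟩
  suc (1 * (n C 1) + 0)                  ≡⟨ lemma (n C 1) ⟩
  1 * (n C 1 + 1) + 0                    ≡⟨ cong (λ x → 1 * x + 0) (pascal n 0) ⟨
  1 * (suc n C 1) + 0 * (suc n C 0)      ∎
  where
  open ≡-Reasoning
  lemma : ∀ x → 1 + (1 * x + 0) ≡ 1 * (x + 1) + 0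
  lemma = solve-∀
absorption (suc n) (suc k) = begin
  suc n * (suc n C suc k)                            ≡⟨ cong (suc n *_) (pascal n k) ⟩
  suc n * (y + z)                                    ≡⟨ split n y z ⟩
  n * y + n * z + y + z                              ≡⟨ cong₂ (λ u v → u + v + y + z) (absorption n (suc k)) (absorption n k) ⟩
  (2 + k) * x + (1 + k) * y + ((1 + k) * y + k * z) + y + z ≡⟨ collect k x y z ⟩
  (2 + k) * (x + y) + (1 + k) * (y + z)              ≡⟨ cong₂ (λ u v → (2 + k) * u + (1 + k) * v) (pascal n (suc k)) (pascal n k) ⟨
  suc (suc k) * (suc n C suc (suc k)) + suc k * (suc n C suc k) ∎
  where
  open ≡-Reasoning
  x = n C suc (suc k)
  y = n C suc k
  z = n C k
  split : ∀ n y z → (1 + n) * (y + z) ≡ n * y + n * z + y + z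
  split = solve-∀
  collect : ∀ k x y z → (2 + k) * x + (1 + k) * y + ((1 + k) * y + k * z) + y + z
                      ≡ (2 + k) * (x + y) + (1 + k) * (y + z)
  collect = solve-∀

-- The right side is the product (n + 1)...(n + r). This turns bounds on tuples back into bounds on
-- subsets; the shift of `n` by `r` costs only a lower-order term.
n^r≤r!*[n+r]Cr : ∀ n r → n ^ r ≤ r ! * ((r + n) C r)
n^r≤r!*[n+r]Cr n zero    = ≤-refl
n^r≤r!*[n+r]Cr n (suc r) = begin
  n * n ^ r                                  ≤⟨ *-mono-≤ (n≤1+n n) (n^r≤r!*[n+r]Cr n r) ⟩
  suc n * (r ! * ((r + n) C r))              ≤⟨ *-monoʳ-≤ (suc n) (*-monoʳ-≤ (r !) (C-suc-mono (r + n) r)) ⟩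
  suc n * (r ! * x)                          ≡⟨ swap (suc n) (r !) x ⟩
  r ! * (suc n * x)                          ≤⟨ *-monoʳ-≤ (r !) absorbed ⟩
  r ! * (suc r * ((suc r + n) C suc r))      ≡⟨ assoc (r !) (suc r) _ ⟩
  suc r * r ! * ((suc r + n) C suc r)        ∎
  where
  open ≤-Reasoning
  x = (suc r + n) C r
  swap : ∀ a b c → a * (b * c) ≡ b * (a * c)
  swap = solve-∀
  assoc : ∀ a b c → a * (b * c) ≡ b * a * c
  assoc = solve-∀
  distrib : ∀ r n x → (1 + r + n) * x ≡ (1 + n) * x + r * x
  distrib = solve-∀
  absorbed : suc n * x ≤ suc r * ((suc r + n) C suc r)
  absorbed = +-cancelʳ-≤ (r * x) _ _ (≤-reflexive
    (trans (sym (distrib r n x)) (absorption (suc r + n) r)))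

-- Of the (r + 1)-subsets of m pairs, the first term counts the transversals. Any other contains a
-- full pair, so it arises from an r-subset by adding the partner of one of its elements. The
-- induction removes a pair, by Pascal's rule applied twice.
2m-C : ∀ m r → (m + m) C suc r ≤ 2 ^ suc r * (m C suc r) + suc r * ((m + m) C r)
2m-C zero    r       = z≤n
2m-C (suc m) zero    = begin
  (suc m + suc m) C 1                     ≡⟨ nC1≡n (suc m + suc m) ⟩
  suc m + suc m                           ≡⟨ cong (λ x → x + x) (nC1≡n (suc m)) ⟨
  suc m C 1 + suc m C 1                   ≡⟨ double (suc m C 1) ⟩
  2 * (suc m C 1)                         ≤⟨ m≤m+n _ _ ⟩
  2 * (suc m C 1) + 1                     ∎
  where
  open ≤-Reasoning
  double : ∀ x → x + x ≡ 2 * x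
  double = solve-∀
2m-C (suc m) (suc r) = begin
  (suc m + suc m) C suc (suc r)                      ≡⟨ pascal² (suc r) ⟩
  a + 2 * b + c                                      ≤⟨ +-monoˡ-≤ c (+-mono-≤ (2m-C m (suc r)) (*-monoʳ-≤ 2 (2m-C m r))) ⟩
  2 * (2 * p) * u + (2 + r) * b + 2 * (2 * p * v + (1 + r) * c) + c
                                                     ≤⟨ m≤m+n _ (c + (2 + r) * e) ⟩
  2 * (2 * p) * u + (2 + r) * b + 2 * (2 * p * v + (1 + r) * c) + c + (c + (2 + r) * e)
                                                     ≡⟨ collect p u v r b c e ⟩
  2 * (2 * p) * (u + v) + (2 + r) * (b + 2 * c + e)  ≡⟨ cong₂ (λ x y → 2 * (2 * p) * x + (2 + r) * y) (pascal m (suc r)) b+2c+e ⟨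
  2 * (2 * p) * (suc m C suc (suc r)) + (2 + r) * ((suc m + suc m) C suc r) ∎
  where
  open ≤-Reasoning
  a = (m + m) C suc (suc r)
  b = (m + m) C suc r
  c = (m + m) C r
  p = 2 ^ r
  u = m C suc (suc r)
  v = m C suc r
  -- C(2m, r - 1), set to 0 at r = 0 so that the doubled Pascal rule has one form for all r.
  below : ℕ → ℕ
  below zero    = 0
  below (suc r) = (m + m) C r
  e = below r
  regroup : ∀ x y z → x + y + (y + z) ≡ x + 2 * y + z
  regroup = solve-∀
  pascal² : ∀ r → (suc m + suc m) C suc r ≡ (m + m) C suc r + 2 * ((m + m) C r) + below r
  pascal² zero = trans (cong (_C 1) (+-suc (suc m) m)) (trans (pascal (suc (m + m)) 0)
    (trans (cong (_+ 1) (pascal (m + m) 0)) (+1+1 ((m + m) C 1))))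
    where
    +1+1 : ∀ x → x + 1 + 1 ≡ x + 2 + 0
    +1+1 = solve-∀
  pascal² (suc r) = trans (cong (_C suc (suc r)) (+-suc (suc m) m)) (trans (pascal (suc (m + m)) (suc r))
    (trans (cong₂ _+_ (pascal (m + m) (suc r)) (pascal (m + m) r)) (regroup ((m + m) C suc (suc r)) _ _)))
  b+2c+e : (suc m + suc m) C suc r ≡ b + 2 * c + e
  b+2c+e = pascal² r
  collect : ∀ p u v r b c e →
    2 * (2 * p) * u + (2 + r) * b + 2 * (2 * p * v + (1 + r) * c) + c + (c + (2 + r) * e)
    ≡ 2 * (2 * p) * (u + v) + (2 + r) * (b + 2 * c + e)
  collect = solve-∀

-- That is, C(m + c, r) = o(C(m, r + 1)).
C-dominates : ∀ A c r m → suc r * (c + A) + r ≤ m → A * ((c + m) C r) ≤ m C suc r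
C-dominates A c r m large = *-cancelˡ-≤ (suc r) (+-cancelʳ-≤ (suc r * (c * x) + r * x) _ _ (begin
  suc r * (A * x) + (suc r * (c * x) + r * x)  ≡⟨ factor r A c x ⟩
  (suc r * (c + A) + r) * x                    ≤⟨ *-monoˡ-≤ x (≤-trans large (m≤n+m m c)) ⟩
  (c + m) * x                                  ≡⟨ absorption (c + m) r ⟩
  suc r * ((c + m) C suc r) + r * x            ≤⟨ +-monoˡ-≤ (r * x) (*-monoʳ-≤ (suc r) (C-+-error c m r)) ⟩
  suc r * (m C suc r + c * x) + r * x          ≡⟨ expand r (m C suc r) c x ⟩
  suc r * (m C suc r) + (suc r * (c * x) + r * x) ∎))
  where
  open ≤-Reasoning
  x = (c + m) C r
  factor : ∀ r A c x → (1 + r) * (A * x) + ((1 + r) * (c * x) + r * x) ≡ ((1 + r) * (c + A) + r) * x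
  factor = solve-∀
  expand : ∀ r b c x → (1 + r) * (b + c * x) + r * x ≡ (1 + r) * b + ((1 + r) * (c * x) + r * x)
  expand = solve-∀

C-positive : ∀ r m → r ≤ m → 1 ≤ m C r
C-positive zero    m       _         = ≤-refl
C-positive (suc r) (suc m) (s≤s r≤m) =
  ≤-trans (C-positive r m r≤m) (≤-trans (m≤n+m _ _) (≤-reflexive (sym (pascal m r))))

-- Weighted counts of subsets

-- Σ_t C(a,t) C(b,r-t) w(t): the r-subsets of a set of a + b points, each
-- weighted according to its number t of elements among the first a points.
Sel : (a b r : ℕ) → (ℕ → ℕ) → ℕ
Sel zero    b r       w = (b C r) * w 0
Sel (suc a) b zero    w = w 0
Sel (suc a) b (suc r) w = Sel a b (suc r) w + Sel a b r (w ∘ suc)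

Sel-zero : ∀ a b w → Sel a b 0 w ≡ w 0
Sel-zero zero    b w = +-identityʳ (w 0)
Sel-zero (suc a) b w = refl

+-interchange : ∀ a b c d → (a + b) + (c + d) ≡ (a + c) + (b + d)
+-interchange = solve-∀

-- The definition peels off points of the first kind only; this is the same recursion for the second
-- kind.
Sel-sucʳ : ∀ a b r w → Sel a (suc b) (suc r) w ≡ Sel a b (suc r) w + Sel a b r w
Sel-sucʳ zero    b r       w = trans (cong (_* w 0) (pascal b r)) (*-distribʳ-+ (w 0) (b C suc r) (b C r))
Sel-sucʳ (suc a) b zero    w = begin
  Sel a (suc b) 1 w + Sel a (suc b) 0 (w ∘ suc)
    ≡⟨ cong₂ _+_ (Sel-sucʳ a b 0 w) (trans (Sel-zero a (suc b) (w ∘ suc)) (sym (Sel-zero a b (w ∘ suc)))) ⟩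
  Sel a b 1 w + Sel a b 0 w + Sel a b 0 (w ∘ suc)
    ≡⟨ cong (λ x → Sel a b 1 w + x + Sel a b 0 (w ∘ suc)) (Sel-zero a b w) ⟩
  Sel a b 1 w + w 0 + Sel a b 0 (w ∘ suc)
    ≡⟨ comm (Sel a b 1 w) (w 0) _ ⟩
  Sel a b 1 w + Sel a b 0 (w ∘ suc) + w 0 ∎
  where
  open ≡-Reasoning
  comm : ∀ x y z → x + y + z ≡ x + z + y
  comm = solve-∀
Sel-sucʳ (suc a) b (suc r) w = trans
  (cong₂ _+_ (Sel-sucʳ a b (suc r) w) (Sel-sucʳ a b r (w ∘ suc)))
  (+-interchange (Sel a b (suc (suc r)) w) (Sel a b (suc r) w) (Sel a b (suc r) (w ∘ suc)) (Sel a b r (w ∘ suc)))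

Sel-mono : ∀ a b r {v w : ℕ → ℕ} → (∀ t → v t ≤ w t) → Sel a b r v ≤ Sel a b r w
Sel-mono zero    b r       v≤w = *-monoʳ-≤ (b C r) (v≤w 0)
Sel-mono (suc a) b zero    v≤w = v≤w 0
Sel-mono (suc a) b (suc r) v≤w = +-mono-≤ (Sel-mono a b (suc r) v≤w) (Sel-mono a b r (v≤w ∘ suc))

Sel-cong : ∀ a b r {v w : ℕ → ℕ} → (∀ t → v t ≡ w t) → Sel a b r v ≡ Sel a b r w
Sel-cong a b r v≡w = ≤-antisym (Sel-mono a b r (≤-reflexive ∘ v≡w)) (Sel-mono a b r (≤-reflexive ∘ sym ∘ v≡w))

Sel-+ : ∀ a b r v w → Sel a b r (λ t → v t + w t) ≡ Sel a b r v + Sel a b r w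
Sel-+ zero    b r       v w = *-distribˡ-+ (b C r) (v 0) (w 0)
Sel-+ (suc a) b zero    v w = refl
Sel-+ (suc a) b (suc r) v w = trans
  (cong₂ _+_ (Sel-+ a b (suc r) v w) (Sel-+ a b r (v ∘ suc) (w ∘ suc)))
  (+-interchange (Sel a b (suc r) v) _ _ _)

Sel-one : ∀ a b r → Sel a b r (λ _ → 1) ≡ (a + b) C r
Sel-one zero    b r       = *-identityʳ (b C r)
Sel-one (suc a) b zero    = refl
Sel-one (suc a) b (suc r) = trans (cong₂ _+_ (Sel-one a b (suc r)) (Sel-one a b r)) (sym (pascal (a + b) r))

Sel-≤1 : ∀ a b r {w} → w ≤1 → Sel a b r w ≤ (a + b) C r
Sel-≤1 a b r w≤1 = ≤-trans (Sel-mono a b r w≤1) (≤-reflexive (Sel-one a b r))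

Sel-suc-monoˡ : ∀ a b r w → Sel a b r w ≤ Sel (suc a) b r w
Sel-suc-monoˡ a b zero    w = ≤-reflexive (Sel-zero a b w)
Sel-suc-monoˡ a b (suc r) w = m≤m+n _ _

Sel-suc-monoʳ : ∀ a b r w → Sel a b r w ≤ Sel a (suc b) r w
Sel-suc-monoʳ a b zero    w = ≤-reflexive (trans (Sel-zero a b w) (sym (Sel-zero a (suc b) w)))
Sel-suc-monoʳ a b (suc r) w = ≤-trans (m≤m+n _ _) (≤-reflexive (sym (Sel-sucʳ a b r w)))

Sel-monoˡʳ : ∀ {a a′ b b′} r w → a ≤ a′ → b ≤ b′ → Sel a b r w ≤ Sel a′ b′ r w
Sel-monoˡʳ {a} {a′} {b} {b′} r w a≤a′ b≤b′ =
  ≤-trans (left (≤⇒≤′ a≤a′)) (right (≤⇒≤′ b≤b′))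
  where
  left : ∀ {a′} → a ≤′ a′ → Sel a b r w ≤ Sel a′ b r w
  left ≤′-refl            = ≤-refl
  left (≤′-step {n} a≤n)  = ≤-trans (left a≤n) (Sel-suc-monoˡ n b r w)
  right : ∀ {b′} → b ≤′ b′ → Sel a′ b r w ≤ Sel a′ b′ r w
  right ≤′-refl           = ≤-refl
  right (≤′-step {n} b≤n) = ≤-trans (right b≤n) (Sel-suc-monoʳ a′ n r w)

-- As `w 0` vanishes, a counted subset contains one of the `a` points: choose that point, then `r`
-- others. For bounded `a` this is of lower order.
Sel-fewˡ : ∀ a b r {w} → w ≤1 → w 0 ≡ 0 → Sel a b (suc r) w ≤ a * ((a + b) C r)
Sel-fewˡ zero    b r {w} w≤1 w0 = ≤-reflexive (trans (cong ((b C suc r) *_) w0) (*-zeroʳ (b C suc r)))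
Sel-fewˡ (suc a) b r {w} w≤1 w0 = begin
  Sel a b (suc r) w + Sel a b r (w ∘ suc)        ≤⟨ +-mono-≤ (Sel-fewˡ a b r w≤1 w0) (Sel-≤1 a b r (w≤1 ∘ suc)) ⟩
  a * ((a + b) C r) + (a + b) C r                ≡⟨ +-comm _ ((a + b) C r) ⟩
  suc a * ((a + b) C r)                          ≤⟨ *-monoʳ-≤ (suc a) (C-suc-mono (a + b) r) ⟩
  suc a * ((suc a + b) C r)                      ∎
  where open ≤-Reasoning

Sel-vanishes : ∀ a r w → w r ≡ 0 → Sel a 0 r w ≡ 0
Sel-vanishes zero    zero    w wr = trans (+-identityʳ (w 0)) wr
Sel-vanishes zero    (suc r) w wr = refl
Sel-vanishes (suc a) zero    w wr = wr
Sel-vanishes (suc a) (suc r) w wr = cong₂ _+_ (Sel-vanishes a (suc r) w wr) (Sel-vanishes a r (w ∘ suc) wr)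

-- The mirror image: a weight vanishing at `suc r` forces an element among the `b` points.
Sel-fewʳ : ∀ a b r {w} → w ≤1 → w (suc r) ≡ 0 → Sel a b (suc r) w ≤ b * ((a + b) C r)
Sel-fewʳ a zero    r {w} w≤1 wr = ≤-reflexive (Sel-vanishes a (suc r) w wr)
Sel-fewʳ a (suc b) r {w} w≤1 wr = begin
  Sel a (suc b) (suc r) w              ≡⟨ Sel-sucʳ a b r w ⟩
  Sel a b (suc r) w + Sel a b r w      ≤⟨ +-mono-≤ (Sel-fewʳ a b r w≤1 wr) (Sel-≤1 a b r w≤1) ⟩
  b * ((a + b) C r) + (a + b) C r      ≡⟨ +-comm _ ((a + b) C r) ⟩
  suc b * ((a + b) C r)                ≤⟨ *-monoʳ-≤ (suc b) (C-mono r (+-monoʳ-≤ a (n≤1+n b))) ⟩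
  suc b * ((a + suc b) C r)            ∎
  where open ≤-Reasoning

-- Weighted counts of tuples

-- The r-tuples over a + b points, weighted in the same way.
Tup : (a b r : ℕ) → (ℕ → ℕ) → ℕ
Tup a b zero    w = w 0
Tup a b (suc r) w = b * Tup a b r w + a * Tup a b r (w ∘ suc)

-- Mark an element of each (r + 1)-subset and take it out. Equality is lost because the marked
-- element is then allowed to be any of the `a + b` points.
Sel-remove : ∀ a b r w → suc r * Sel a b (suc r) w ≤ a * Sel a b r (w ∘ suc) + b * Sel a b r w
Sel-remove zero    b r       w = begin
  suc r * ((b C suc r) * w 0)           ≡⟨ *-assoc (suc r) (b C suc r) (w 0) ⟨
  suc r * (b C suc r) * w 0             ≤⟨ *-monoˡ-≤ (w 0) (m≤m+n (suc r * (b C suc r)) (r * (b C r))) ⟩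
  (suc r * (b C suc r) + r * (b C r)) * w 0 ≡⟨ cong (_* w 0) (absorption b r) ⟨
  b * (b C r) * w 0                     ≡⟨ *-assoc b (b C r) (w 0) ⟩
  b * ((b C r) * w 0)                   ∎
  where open ≤-Reasoning
Sel-remove (suc a) b zero    w = begin
  1 * (Sel a b 1 w + Sel a b 0 (w ∘ suc))
    ≡⟨ cong₂ (λ x y → 1 * (x + y)) (sym (+-identityʳ (Sel a b 1 w))) (Sel-zero a b (w ∘ suc)) ⟩
  1 * (1 * Sel a b 1 w + w 1)
    ≤⟨ *-monoʳ-≤ 1 (+-monoˡ-≤ (w 1) (Sel-remove a b 0 w)) ⟩
  1 * (a * Sel a b 0 (w ∘ suc) + b * Sel a b 0 w + w 1)
    ≡⟨ cong₂ (λ x y → 1 * (a * x + b * y + w 1)) (Sel-zero a b (w ∘ suc)) (Sel-zero a b w) ⟩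
  1 * (a * w 1 + b * w 0 + w 1)
    ≡⟨ collect a (w 1) (b * w 0) ⟩
  suc a * w 1 + b * w 0 ∎
  where
  open ≤-Reasoning
  collect : ∀ a x y → 1 * (a * x + y + x) ≡ (1 + a) * x + y
  collect = solve-∀
Sel-remove (suc a) b (suc r) w = begin
  suc (suc r) * (Sel a b (suc (suc r)) w + y)
    ≡⟨ distrib r (Sel a b (suc (suc r)) w) y ⟩
  suc (suc r) * Sel a b (suc (suc r)) w + suc r * y + y
    ≤⟨ +-monoˡ-≤ y (+-mono-≤ (Sel-remove a b (suc r) w) (Sel-remove a b r (w ∘ suc))) ⟩
  a * y + b * x + (a * z + b * u) + y
    ≤⟨ m≤m+n _ z ⟩
  a * y + b * x + (a * z + b * u) + y + z
    ≡⟨ collect a b x y z u ⟩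
  suc a * (y + z) + b * (x + u) ∎
  where
  open ≤-Reasoning
  x = Sel a b (suc r) w
  y = Sel a b (suc r) (w ∘ suc)
  z = Sel a b r (w ∘ suc ∘ suc)
  u = Sel a b r (w ∘ suc)
  distrib : ∀ r s y → (2 + r) * (s + y) ≡ (2 + r) * s + (1 + r) * y + y
  distrib = solve-∀
  collect : ∀ a b x y z u → a * y + b * x + (a * z + b * u) + y + z ≡ (1 + a) * (y + z) + b * (x + u)
  collect = solve-∀

-- Each r-subset has `r !` orderings, and tuples may in addition repeat points. Tuples are preferred
-- because their recursion keeps `a` and `b` fixed, so that powers of one element of ℤ[ω] appear.
r!*Sel≤Tup : ∀ a b r w → r ! * Sel a b r w ≤ Tup a b r w
r!*Sel≤Tup a b zero    w = ≤-reflexive (trans (+-identityʳ _) (Sel-zero a b w))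
r!*Sel≤Tup a b (suc r) w = begin
  suc r * r ! * Sel a b (suc r) w                             ≡⟨ comm (suc r) (r !) _ ⟩
  r ! * (suc r * Sel a b (suc r) w)                           ≤⟨ *-monoʳ-≤ (r !) (Sel-remove a b r w) ⟩
  r ! * (a * Sel a b r (w ∘ suc) + b * Sel a b r w)           ≡⟨ distrib (r !) a _ b _ ⟩
  b * (r ! * Sel a b r w) + a * (r ! * Sel a b r (w ∘ suc))
    ≤⟨ +-mono-≤ (*-monoʳ-≤ b (r!*Sel≤Tup a b r w)) (*-monoʳ-≤ a (r!*Sel≤Tup a b r (w ∘ suc))) ⟩
  b * Tup a b r w + a * Tup a b r (w ∘ suc)                   ∎
  where
  open ≤-Reasoning
  comm : ∀ x y z → x * y * z ≡ y * (x * z)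
  comm = solve-∀
  distrib : ∀ f a x b y → f * (a * x + b * y) ≡ b * (f * y) + a * (f * x)
  distrib = solve-∀

-- Among the r-subsets of m pairs, the transversals: choose r pairs, then an
-- end of each; the latter choices are the r-tuples over 1 + 1 points.
Sel-transversals : ∀ m r w → (m C r) * Tup 1 1 r w ≤ Sel m m r w
Sel-transversals m       zero    w = ≤-reflexive (trans (+-identityʳ (w 0)) (sym (Sel-zero m m w)))
Sel-transversals zero    (suc r) w = z≤n
Sel-transversals (suc m) (suc r) w = begin
  (suc m C suc r) * T                                     ≡⟨ cong (_* T) (pascal m r) ⟩
  (m C suc r + m C r) * T                                 ≡⟨ distrib (m C suc r) (m C r) (Tup 1 1 r w) (Tup 1 1 r (w ∘ suc)) ⟩
  (m C suc r) * T + (m C r) * Tup 1 1 r w + (m C r) * Tup 1 1 r (w ∘ suc)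
    ≤⟨ +-mono-≤ (+-mono-≤ (Sel-transversals m (suc r) w) (Sel-transversals m r w)) (Sel-transversals m r (w ∘ suc)) ⟩
  Sel m m (suc r) w + Sel m m r w + Sel m m r (w ∘ suc)   ≡⟨ cong (_+ Sel m m r (w ∘ suc)) (Sel-sucʳ m m r w) ⟨
  Sel m (suc m) (suc r) w + Sel m m r (w ∘ suc)           ≤⟨ +-monoʳ-≤ _ (Sel-suc-monoʳ m m r (w ∘ suc)) ⟩
  Sel m (suc m) (suc r) w + Sel m (suc m) r (w ∘ suc)     ∎
  where
  open ≤-Reasoning
  T = Tup 1 1 (suc r) w
  distrib : ∀ c d x y → (c + d) * (1 * x + 1 * y) ≡ c * (1 * x + 1 * y) + d * x + d * y
  distrib = solve-∀

Tup-cong : ∀ a b r {v w : ℕ → ℕ} → (∀ t → v t ≡ w t) → Tup a b r v ≡ Tup a b r w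
Tup-cong a b zero    v≡w = v≡w 0
Tup-cong a b (suc r) v≡w = cong₂ _+_ (cong (b *_) (Tup-cong a b r v≡w)) (cong (a *_) (Tup-cong a b r (v≡w ∘ suc)))

-- Three residue classes and the norm of ℤ[ω]

-- Abstracts the indicator of a residue class modulo 3: of three consecutive values exactly one is
-- 1. The notion is closed under shifts, as the recursion of `Tup` requires; `w`, `w ∘ suc` and
-- `w ∘ suc ∘ suc` stand for the three classes.
record Partition₃ (w : ℕ → ℕ) : Set where
  field
    periodic : ∀ t → w (3 + t) ≡ w t
    total    : ∀ t → w t + w (1 + t) + w (2 + t) ≡ 1

open Partition₃

shift₃ : ∀ {w} → Partition₃ w → Partition₃ (w ∘ suc)
shift₃ pw = record { periodic = periodic pw ∘ suc ; total = total pw ∘ suc }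

Tup-periodic : ∀ a b r {w} → Partition₃ w → Tup a b r (w ∘ suc ∘ suc ∘ suc) ≡ Tup a b r w
Tup-periodic a b r pw = Tup-cong a b r (periodic pw)

Tup-total : ∀ a b r {w} → Partition₃ w →
  Tup a b r w + Tup a b r (w ∘ suc) + Tup a b r (w ∘ suc ∘ suc) ≡ (a + b) ^ r
Tup-total a b zero    pw = total pw 0
Tup-total a b (suc r) {w} pw = begin
  b * x + a * y + (b * y + a * z) + (b * z + a * x′)  ≡⟨ cong (λ u → b * x + a * y + (b * y + a * z) + (b * z + a * u)) (Tup-periodic a b r pw) ⟩
  b * x + a * y + (b * y + a * z) + (b * z + a * x)   ≡⟨ factor a b x y z ⟩
  (a + b) * (x + y + z)                               ≡⟨ cong ((a + b) *_) (Tup-total a b r pw) ⟩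
  (a + b) * (a + b) ^ r                               ∎
  where
  open ≡-Reasoning
  x = Tup a b r w
  y = Tup a b r (w ∘ suc)
  z = Tup a b r (w ∘ suc ∘ suc)
  x′ = Tup a b r (w ∘ suc ∘ suc ∘ suc)
  factor : ∀ a b x y z → b * x + a * y + (b * y + a * z) + (b * z + a * x) ≡ (a + b) * (x + y + z)
  factor = solve-∀

-- Equivalent to a² - ab + b² = ∣a - b∣² + ab, whose right side is free of signed subtraction.
a²+b²≡∣a-b∣²+2ab : ∀ a b → a * a + b * b ≡ ∣ a - b ∣ * ∣ a - b ∣ + (a * b + a * b)
a²+b²≡∣a-b∣²+2ab zero    b       = sym (+-identityʳ (b * b))
a²+b²≡∣a-b∣²+2ab (suc a) zero    = cong (_+_ (suc a * suc a)) (sym (cong₂ _+_ (*-zeroʳ (suc a)) (*-zeroʳ (suc a))))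
a²+b²≡∣a-b∣²+2ab (suc a) (suc b) = begin
  suc a * suc a + suc b * suc b                ≡⟨ expand a b ⟩
  a * a + b * b + (2 * a + 2 * b + 2)          ≡⟨ cong (_+ (2 * a + 2 * b + 2)) (a²+b²≡∣a-b∣²+2ab a b) ⟩
  h * h + (a * b + a * b) + (2 * a + 2 * b + 2) ≡⟨ collect a b (h * h) ⟩
  h * h + (suc a * suc b + suc a * suc b)      ∎
  where
  open ≡-Reasoning
  h = ∣ a - b ∣
  expand : ∀ a b → (1 + a) * (1 + a) + (1 + b) * (1 + b) ≡ a * a + b * b + (2 * a + 2 * b + 2)
  expand = solve-∀
  collect : ∀ a b k → k + (a * b + a * b) + (2 * a + 2 * b + 2) ≡ k + ((1 + a) * (1 + b) + (1 + a) * (1 + b))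
  collect = solve-∀

^-distrib-* : ∀ a b r → (a * b) ^ r ≡ a ^ r * b ^ r
^-distrib-* a b zero    = refl
^-distrib-* a b (suc r) = trans (cong (a * b *_) (^-distrib-* a b r)) (interchange a b (a ^ r) (b ^ r))
  where
  interchange : ∀ a b c d → a * b * (c * d) ≡ a * c * (b * d)
  interchange = solve-∀

-- The norm of x + yω + zω² is `squares` minus `products`; keeping the two apart avoids subtraction
-- in ℕ.
squares : ℕ → ℕ → ℕ → ℕ
squares x y z = x * x + y * y + z * z

products : ℕ → ℕ → ℕ → ℕ
products x y z = x * y + y * z + z * x

-- a² - ab + b², the norm of a + bω
norm : ℕ → ℕ → ℕ
norm a b = ∣ a - b ∣ * ∣ a - b ∣ + a * b

-- The two sides differ by 3∣a - b∣².
[a+b]²≤4*norm : ∀ a b → (a + b) * (a + b) ≤ 4 * norm a b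
[a+b]²≤4*norm a b = begin
  (a + b) * (a + b)                    ≡⟨ square a b ⟩
  a * a + b * b + (a * b + a * b)      ≡⟨ cong (_+ (a * b + a * b)) (a²+b²≡∣a-b∣²+2ab a b) ⟩
  k + (a * b + a * b) + (a * b + a * b) ≤⟨ m≤m+n _ (3 * k) ⟩
  k + (a * b + a * b) + (a * b + a * b) + 3 * k ≡⟨ collect k (a * b) ⟩
  4 * (k + a * b)                      ∎
  where
  open ≤-Reasoning
  k = ∣ a - b ∣ * ∣ a - b ∣
  square : ∀ a b → (a + b) * (a + b) ≡ a * a + b * b + (a * b + a * b)
  square = solve-∀
  collect : ∀ k c → k + (c + c) + (c + c) + 3 * k ≡ 4 * (k + c)
  collect = solve-∀

-- Multiplicativity of the norm of x + yω + zω².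
norm-* : ∀ a b x y z q → squares x y z ≡ products x y z + q →
  let x′ = b * x + a * y ; y′ = b * y + a * z ; z′ = b * z + a * x in
  squares x′ y′ z′ ≡ products x′ y′ z′ + norm a b * q
norm-* a b x y z q eq = +-cancelʳ-≡ (c * squares x y z + (k + (c + c)) * products x y z) _ _ (begin
  squares x′ y′ z′ + (c * squares x y z + (k + (c + c)) * products x y z)
    ≡⟨ cong (λ u → squares x′ y′ z′ + (c * squares x y z + u * products x y z)) (a²+b²≡∣a-b∣²+2ab a b) ⟨
  squares x′ y′ z′ + (c * squares x y z + (a * a + b * b) * products x y z)
    ≡⟨ identity a b x y z ⟩
  products x′ y′ z′ + ((a * a + b * b) * squares x y z + c * products x y z)
    ≡⟨ cong (λ u → products x′ y′ z′ + (u * squares x y z + c * products x y z)) (a²+b²≡∣a-b∣²+2ab a b) ⟩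
  products x′ y′ z′ + ((k + (c + c)) * squares x y z + c * products x y z)
    ≡⟨ cong (λ u → products x′ y′ z′ + ((k + (c + c)) * u + c * products x y z)) eq ⟩
  products x′ y′ z′ + ((k + (c + c)) * (products x y z + q) + c * products x y z)
    ≡⟨ collect (products x′ y′ z′) k c (products x y z) q ⟩
  products x′ y′ z′ + (k + c) * q + (c * (products x y z + q) + (k + (c + c)) * products x y z)
    ≡⟨ cong (λ u → products x′ y′ z′ + (k + c) * q + (c * u + (k + (c + c)) * products x y z)) eq ⟨
  products x′ y′ z′ + (k + c) * q + (c * squares x y z + (k + (c + c)) * products x y z) ∎)
  where
  open ≡-Reasoning
  k = ∣ a - b ∣ * ∣ a - b ∣
  c = a * b
  x′ = b * x + a * y
  y′ = b * y + a * z
  z′ = b * z + a * x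
  identity : ∀ a b x y z →
    (b * x + a * y) * (b * x + a * y) + (b * y + a * z) * (b * y + a * z) + (b * z + a * x) * (b * z + a * x)
      + (a * b * (x * x + y * y + z * z) + (a * a + b * b) * (x * y + y * z + z * x))
    ≡ (b * x + a * y) * (b * y + a * z) + (b * y + a * z) * (b * z + a * x) + (b * z + a * x) * (b * x + a * y)
      + ((a * a + b * b) * (x * x + y * y + z * z) + a * b * (x * y + y * z + z * x))
  identity = solve-∀
  collect : ∀ p k c t q → p + ((k + (c + c)) * (t + q) + c * t) ≡ p + (k + c) * q + (c * (t + q) + (k + (c + c)) * t)
  collect = solve-∀

-- One step of `Tup` multiplies x + yω + zω² by b + aω², whose norm is `norm a b`; at length 0 the
-- element is one of 1, ω, ω².
Tup-norm : ∀ a b r {w} → Partition₃ w →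
  let x = Tup a b r w ; y = Tup a b r (w ∘ suc) ; z = Tup a b r (w ∘ suc ∘ suc) in
  squares x y z ≡ products x y z + norm a b ^ r
Tup-norm a b zero {w} pw = unit (w 0) (w 1) (w 2) (total pw 0)
  where
  unit : ∀ x y z → x + y + z ≡ 1 → squares x y z ≡ products x y z + 1
  unit 0 0 1 _ = refl
  unit 0 1 0 _ = refl
  unit 1 0 0 _ = refl
  unit 0 0 (suc (suc _)) ()
  unit 0 1 (suc _) ()
  unit 0 (suc (suc _)) _ ()
  unit 1 0 (suc _) ()
  unit 1 (suc _) _ ()
  unit (suc (suc _)) _ _ ()
Tup-norm a b (suc r) {w} pw = begin
  squares x′ y′ (b * z + a * Tup a b r (w ∘ suc ∘ suc ∘ suc))
    ≡⟨ cong (λ u → squares x′ y′ (b * z + a * u)) (Tup-periodic a b r pw) ⟩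
  squares x′ y′ (b * z + a * x)
    ≡⟨ norm-* a b x y z (norm a b ^ r) (Tup-norm a b r pw) ⟩
  products x′ y′ (b * z + a * x) + norm a b * norm a b ^ r
    ≡⟨ cong (λ u → products x′ y′ (b * z + a * u) + norm a b * norm a b ^ r) (Tup-periodic a b r pw) ⟨
  products x′ y′ (b * z + a * Tup a b r (w ∘ suc ∘ suc ∘ suc)) + norm a b * norm a b ^ r ∎
  where
  open ≡-Reasoning
  x = Tup a b r w
  y = Tup a b r (w ∘ suc)
  z = Tup a b r (w ∘ suc ∘ suc)
  x′ = b * x + a * y
  y′ = b * y + a * z

-- Since 1 + ω + ω² = 0, subtracting `μ` from all three coordinates keeps the norm `q`. Then (x + y
-- + z)² is `squares` plus twice `products`, which exceeds their difference `q`.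
norm≤[excess]² : ∀ μ x y z q → squares (μ + x) (μ + y) (μ + z) ≡ products (μ + x) (μ + y) (μ + z) + q →
  q ≤ (x + y + z) * (x + y + z)
norm≤[excess]² μ x y z q eq = begin
  q                                              ≤⟨ m≤n+m q (3 * products x y z) ⟩
  3 * products x y z + q                         ≡⟨ regroup (products x y z) q ⟩
  2 * products x y z + (products x y z + q)      ≡⟨ cong (_+_ (2 * products x y z)) translated ⟨
  2 * products x y z + squares x y z             ≡⟨ square x y z ⟩
  (x + y + z) * (x + y + z)                      ∎
  where
  open ≤-Reasoning
  c = 3 * (μ * μ) + 2 * (μ * (x + y + z))
  regroup : ∀ p q → 3 * p + q ≡ 2 * p + (p + q)
  regroup = solve-∀
  expandˢ : ∀ μ x y z → (μ + x) * (μ + x) + (μ + y) * (μ + y) + (μ + z) * (μ + z)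
                      ≡ x * x + y * y + z * z + (3 * (μ * μ) + 2 * (μ * (x + y + z)))
  expandˢ = solve-∀
  expandᵖ : ∀ μ x y z q → (μ + x) * (μ + y) + (μ + y) * (μ + z) + (μ + z) * (μ + x) + q
                        ≡ x * y + y * z + z * x + q + (3 * (μ * μ) + 2 * (μ * (x + y + z)))
  expandᵖ = solve-∀
  translated : squares x y z ≡ products x y z + q
  translated = +-cancelʳ-≡ c _ _ (trans (sym (expandˢ μ x y z)) (trans eq (expandᵖ μ x y z q)))
  square : ∀ x y z → 2 * (x * y + y * z + z * x) + (x * x + y * y + z * z) ≡ (x + y + z) * (x + y + z)
  square = solve-∀

*-self-cancel-≤ : ∀ m n → m * m ≤ n * n → m ≤ n
*-self-cancel-≤ m n m²≤n² = ≮⇒≥ (λ n<m → <⇒≱ (*-mono-< n<m n<m) m²≤n²)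

-- The total (a + b)^r equals 3μ + σ, where σ sums the excesses over `μ`, and the norm gives 2^r σ ≥
-- (a + b)^r.
Tup-min : ∀ a b r {w} μ → Partition₃ w →
  μ ≤ Tup a b r w → μ ≤ Tup a b r (w ∘ suc) → μ ≤ Tup a b r (w ∘ suc ∘ suc) →
  3 * 2 ^ r * μ + (a + b) ^ r ≤ 2 ^ r * (a + b) ^ r
Tup-min a b r {w} μ pw μ≤x μ≤y μ≤z = begin
  3 * 2 ^ r * μ + (a + b) ^ r              ≤⟨ +-monoʳ-≤ (3 * 2 ^ r * μ) N^r≤2^rσ ⟩
  3 * 2 ^ r * μ + 2 ^ r * σ                ≡⟨ factor (2 ^ r) μ x₁ y₁ z₁ ⟩
  2 ^ r * ((μ + x₁) + (μ + y₁) + (μ + z₁)) ≡⟨ cong (2 ^ r *_) (cong₂ _+_ (cong₂ _+_ ex ey) ez) ⟩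
  2 ^ r * (x + y + z)                      ≡⟨ cong (2 ^ r *_) (Tup-total a b r pw) ⟩
  2 ^ r * (a + b) ^ r                      ∎
  where
  open ≤-Reasoning
  x = Tup a b r w
  y = Tup a b r (w ∘ suc)
  z = Tup a b r (w ∘ suc ∘ suc)
  x₁ = x ∸ μ
  y₁ = y ∸ μ
  z₁ = z ∸ μ
  σ = x₁ + y₁ + z₁
  ex = m+[n∸m]≡n μ≤x
  ey = m+[n∸m]≡n μ≤y
  ez = m+[n∸m]≡n μ≤z
  factor : ∀ p μ x y z → 3 * p * μ + p * (x + y + z) ≡ p * ((μ + x) + (μ + y) + (μ + z))
  factor = solve-∀
  square-* : ∀ p s → p * p * (s * s) ≡ (p * s) * (p * s)
  square-* = solve-∀
  norm-eq : squares (μ + x₁) (μ + y₁) (μ + z₁) ≡ products (μ + x₁) (μ + y₁) (μ + z₁) + norm a b ^ r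
  norm-eq rewrite ex | ey | ez = Tup-norm a b r pw
  N^r≤2^rσ : (a + b) ^ r ≤ 2 ^ r * σ
  N^r≤2^rσ = *-self-cancel-≤ _ _ (begin
    (a + b) ^ r * (a + b) ^ r              ≡⟨ ^-distrib-* (a + b) (a + b) r ⟨
    ((a + b) * (a + b)) ^ r                ≤⟨ ^-monoˡ-≤ r ([a+b]²≤4*norm a b) ⟩
    (4 * norm a b) ^ r                     ≡⟨ ^-distrib-* 4 (norm a b) r ⟩
    4 ^ r * norm a b ^ r                   ≡⟨ cong (_* norm a b ^ r) (^-distrib-* 2 2 r) ⟩
    2 ^ r * 2 ^ r * norm a b ^ r           ≤⟨ *-monoʳ-≤ (2 ^ r * 2 ^ r) (norm≤[excess]² μ x₁ y₁ z₁ _ norm-eq) ⟩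
    2 ^ r * 2 ^ r * (σ * σ)                ≡⟨ square-* (2 ^ r) σ ⟩
    (2 ^ r * σ) * (2 ^ r * σ)              ∎)

-- As the three counts sum to 2^r, one step gives 3(x + y) - 2^(r+1) = -(3z - 2^r): deviations
-- merely change sign, starting from -1 or 2 at r = 0.
Tup-near-third : ∀ r {w} → Partition₃ w →
  2 ^ r ≤ 3 * Tup 1 1 r w + 2 × 3 * Tup 1 1 r w ≤ 2 ^ r + 2
Tup-near-third zero {w} pw = ≤-trans (m≤m+n 1 1) (m≤n+m 2 _) , *-monoʳ-≤ 3 w0≤1
  where
  w0≤1 : w 0 ≤ 1
  w0≤1 = subst (w 0 ≤_) (total pw 0) (≤-trans (m≤m+n (w 0) (w 1)) (m≤m+n _ (w 2)))
Tup-near-third (suc r) {w} pw with Tup-near-third r (shift₃ (shift₃ pw))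
... | lower , upper = +-cancelʳ-≤ (3 * z) _ _ below , +-cancelʳ-≤ (3 * z) _ _ above
  where
  open ≤-Reasoning
  x = Tup 1 1 r w
  y = Tup 1 1 r (w ∘ suc)
  z = Tup 1 1 r (w ∘ suc ∘ suc)
  three : 3 * 2 ^ r ≡ 3 * (x + y + z)
  three = cong (3 *_) (sym (Tup-total 1 1 r pw))
  split₁ : ∀ p → 2 * p + (p + 2) ≡ 3 * p + 2
  split₁ = solve-∀
  split₂ : ∀ p c → 3 * p + c ≡ 2 * p + c + p
  split₂ = solve-∀
  join : ∀ x y z → 3 * (x + y + z) + 2 ≡ 3 * (1 * x + 1 * y) + 2 + 3 * z
  join = solve-∀
  join′ : ∀ x y z → 3 * (1 * x + 1 * y) + 3 * z ≡ 3 * (x + y + z)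
  join′ = solve-∀
  swap : ∀ p z → 2 * p + (3 * z + 2) ≡ 2 * p + 2 + 3 * z
  swap = solve-∀
  below : 2 * 2 ^ r + 3 * z ≤ 3 * (1 * x + 1 * y) + 2 + 3 * z
  below = begin
    2 * 2 ^ r + 3 * z               ≤⟨ +-monoʳ-≤ (2 * 2 ^ r) upper ⟩
    2 * 2 ^ r + (2 ^ r + 2)         ≡⟨ split₁ (2 ^ r) ⟩
    3 * 2 ^ r + 2                   ≡⟨ cong (_+ 2) three ⟩
    3 * (x + y + z) + 2             ≡⟨ join x y z ⟩
    3 * (1 * x + 1 * y) + 2 + 3 * z ∎
  above : 3 * (1 * x + 1 * y) + 3 * z ≤ 2 * 2 ^ r + 2 + 3 * z
  above = begin
    3 * (1 * x + 1 * y) + 3 * z     ≡⟨ join′ x y z ⟩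
    3 * (x + y + z)                 ≡⟨ three ⟨
    3 * 2 ^ r                       ≡⟨ +-identityʳ _ ⟨
    3 * 2 ^ r + 0                   ≡⟨ split₂ (2 ^ r) 0 ⟩
    2 * 2 ^ r + 0 + 2 ^ r           ≡⟨ cong (_+ 2 ^ r) (+-identityʳ (2 * 2 ^ r)) ⟩
    2 * 2 ^ r + 2 ^ r               ≤⟨ +-monoʳ-≤ (2 * 2 ^ r) lower ⟩
    2 * 2 ^ r + (3 * z + 2)         ≡⟨ swap (2 ^ r) z ⟩
    2 * 2 ^ r + 2 + 3 * z           ∎

2^r/3≤Tup : ∀ r {w} → Partition₃ w → 2 ^ r ℕ./ 3 ≤ Tup 1 1 r w
2^r/3≤Tup r {w} pw = s≤s⁻¹ (m<n*o⇒m/o<n (begin-strict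
  2 ^ r                   ≤⟨ proj₁ (Tup-near-third r pw) ⟩
  3 * Tup 1 1 r w + 2     ≡⟨ +-comm _ 2 ⟩
  2 + 3 * Tup 1 1 r w     <⟨ n<1+n _ ⟩
  3 + 3 * Tup 1 1 r w     ≡⟨ cong (_+_ 3) (*-comm 3 (Tup 1 1 r w)) ⟩
  suc (Tup 1 1 r w) * 3   ∎))
  where open ≤-Reasoning

-- Residue classes and averaging over them

𝟙 : ∀ {ℓ} {P : Set ℓ} → Dec P → ℕ
𝟙 (yes _) = 1
𝟙 (no _)  = 0

module _ {ℓ} {P : Set ℓ} where
  𝟙≤1 : (P? : Dec P) → 𝟙 P? ≤ 1
  𝟙≤1 (yes _) = ≤-refl
  𝟙≤1 (no _)  = z≤n

  𝟙-yes : (P? : Dec P) → P → 𝟙 P? ≡ 1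
  𝟙-yes (yes _) p = refl
  𝟙-yes (no ¬p) p = contradiction p ¬p

  𝟙-no : (P? : Dec P) → ¬ P → 𝟙 P? ≡ 0
  𝟙-no (yes p) ¬p = contradiction p ¬p
  𝟙-no (no _)  ¬p = refl

𝟙-cong : ∀ {ℓ ℓ′} {P : Set ℓ} {Q : Set ℓ′} (P? : Dec P) (Q? : Dec Q) → (P → Q) → (Q → P) → 𝟙 P? ≡ 𝟙 Q?
𝟙-cong (yes p) Q? f g = sym (𝟙-yes Q? (f p))
𝟙-cong (no ¬p) Q? f g = sym (𝟙-no Q? (¬p ∘ g))

residue : (m : ℕ) .{{_ : NonZero m}} → ℕ → ℕ → ℕ
residue m j t = 𝟙 (t ≋? j [mod m ])

residue≤1 : ∀ m .{{_ : NonZero m}} j → residue m j ≤1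
residue≤1 m j t = 𝟙≤1 (t ≋? j [mod m ])

%-shift-injective : ∀ m .{{_ : NonZero m}} {i e} t → i < e → e < m → ¬ ((i + t) ≋ (e + t) [mod m ])
%-shift-injective m {i} {e} t i<e e<m eq =
  >⇒∤ {{>-nonZero (m<n⇒0<n∸m i<e)}} (≤-<-trans (m∸n≤m e i) e<m)
    (∣m+n∣m⇒∣n (divides ((e + t) ℕ./ m) multiple) (divides (x ℕ./ m) refl))
  where
  open ≡-Reasoning
  x = i + t
  regroup : ∀ i δ t → i + δ + t ≡ i + t + δ
  regroup = solve-∀
  multiple : x ℕ./ m * m + (e ∸ i) ≡ (e + t) ℕ./ m * m
  multiple = +-cancelˡ-≡ (x % m) _ _ (begin
    x % m + (x ℕ./ m * m + (e ∸ i))   ≡⟨ +-assoc (x % m) _ _ ⟨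
    x % m + x ℕ./ m * m + (e ∸ i)     ≡⟨ cong (_+ (e ∸ i)) (m≡m%n+[m/n]*n x m) ⟨
    x + (e ∸ i)                     ≡⟨ regroup i (e ∸ i) t ⟨
    i + (e ∸ i) + t                 ≡⟨ cong (_+ t) (m+[n∸m]≡n (<⇒≤ i<e)) ⟩
    e + t                           ≡⟨ m≡m%n+[m/n]*n (e + t) m ⟩
    (e + t) % m + (e + t) ℕ./ m * m   ≡⟨ cong (_+ (e + t) ℕ./ m * m) eq ⟨
    x % m + (e + t) ℕ./ m * m         ∎)

Σ< : ℕ → (ℕ → ℕ) → ℕ
Σ< zero    f = 0
Σ< (suc n) f = Σ< n f + f n

Σ<-≥ : ∀ n {f μ} → (∀ i → i < n → μ ≤ f i) → n * μ ≤ Σ< n f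
Σ<-≥ zero    μ≤f = z≤n
Σ<-≥ (suc n) {f} {μ} μ≤f =
  ≤-trans (+-mono-≤ (μ≤f n ≤-refl) (Σ<-≥ n (λ i i<n → μ≤f i (m<n⇒m<1+n i<n)))) (≤-reflexive (+-comm (f n) (Σ< n f)))

Σ<-zero : ∀ n {f} → (∀ i → i < n → f i ≡ 0) → Σ< n f ≡ 0
Σ<-zero zero    f≡0 = refl
Σ<-zero (suc n) f≡0 = cong₂ _+_ (Σ<-zero n (λ i i<n → f≡0 i (m<n⇒m<1+n i<n))) (f≡0 n ≤-refl)

Sel-Σ< : ∀ a b r n (w : ℕ → ℕ → ℕ) → Σ< n (λ i → Sel a b r (w i)) ≤ Sel a b r (λ t → Σ< n (λ i → w i t))
Sel-Σ< a b r zero    w = z≤n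
Sel-Σ< a b r (suc n) w = ≤-trans (+-monoˡ-≤ _ (Sel-Σ< a b r n w))
  (≤-reflexive (sym (Sel-+ a b r (λ t → Σ< n (λ i → w i t)) (w n))))

residues-disjoint : ∀ m .{{_ : NonZero m}} j e t → e ≤ m → Σ< e (λ i → residue m j (i + t)) ≤ 1
residues-disjoint m j zero    t e≤m = z≤n
residues-disjoint m j (suc e) t e<m with (e + t) ≋? j [mod m ]
... | no _   = ≤-trans (≤-reflexive (+-identityʳ _)) (residues-disjoint m j e t (<⇒≤ e<m))
... | yes eq = ≤-reflexive (cong (_+ 1) (Σ<-zero e (λ i i<e →
  𝟙-no ((i + t) ≋? j [mod m ]) (λ eq′ → %-shift-injective m t i<e e<m (trans eq′ (sym eq))))))

Sel-average : ∀ m .{{_ : NonZero m}} j a b r e μ → e ≤ m →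
  (∀ i → i < e → μ ≤ Sel a b r (λ t → residue m j (i + t))) → e * μ ≤ (a + b) C r
Sel-average m j a b r e μ e≤m μ≤ = begin
  e * μ                                                   ≤⟨ Σ<-≥ e μ≤ ⟩
  Σ< e (λ i → Sel a b r (λ t → residue m j (i + t)))      ≤⟨ Sel-Σ< a b r e _ ⟩
  Sel a b r (λ t → Σ< e (λ i → residue m j (i + t)))      ≤⟨ Sel-≤1 a b r (λ t → residues-disjoint m j e t e≤m) ⟩
  (a + b) C r                                             ∎
  where open ≤-Reasoning

residue₃ : ∀ j → Partition₃ (residue 3 j)
residue₃ j = record
  { periodic = λ t → 𝟙-cong ((3 + t) ≋? j [mod 3 ]) (t ≋? j [mod 3 ]) (trans (sym (3+t t))) (trans (3+t t))
  ; total    = sums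
  }
  where
  3+t : ∀ t → (3 + t) % 3 ≡ t % 3
  3+t t = trans (cong (_% 3) (+-comm 3 t)) ([m+n]%n≡m%n t 3)
  w = residue 3 j
  rotate : ∀ x y z → x + y + z ≡ z + x + y
  rotate = solve-∀
  base : ∀ ρ → ρ < 3 → 𝟙 (0 ≟ ρ) + 𝟙 (1 ≟ ρ) + 𝟙 (2 ≟ ρ) ≡ 1
  base 0 _ = refl
  base 1 _ = refl
  base 2 _ = refl
  base (suc (suc (suc _))) (s≤s (s≤s (s≤s ())))
  sums : ∀ t → w t + w (1 + t) + w (2 + t) ≡ 1
  sums zero    = base (j % 3) (m%n<n j 3)
  sums (suc t) = trans (rotate (w (1 + t)) (w (2 + t)) (w (3 + t)))
    (trans (cong (λ u → u + w (1 + t) + w (2 + t)) (𝟙-cong ((3 + t) ≋? j [mod 3 ]) (t ≋? j [mod 3 ]) (trans (sym (3+t t))) (trans (3+t t))))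
      (sums t))

-- Maxima and minima of lists

-- A non-empty list attains its maximum; `P 0` answers for the default value on the empty list, such
-- as when no s is admissible.
maximum-elim : ∀ {A : Set} (P : ℕ → Set) (f : A → ℕ) xs → P 0 → (∀ {x} → x ∈ xs → P (f x)) → P (maximum (map f xs))
maximum-elim P f []       P0 Pf = P0
maximum-elim P f (x ∷ xs) P0 Pf = argmax-all id {P = P} (Pf (here refl)) (map⁺ (All.tabulate (Pf ∘ there)))

∈⇒≤maximum : ∀ {x xs} → x ∈ xs → x ≤ maximum xs
∈⇒≤maximum {xs = y ∷ ys} (here refl) = ⊥≤max y ys
∈⇒≤maximum {xs = y ∷ ys} (there x∈)  = All.lookup (xs≤max y ys) x∈

∈⇒minimum≤ : ∀ {x xs} → x ∈ xs → minimum xs ≤ x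
∈⇒minimum≤ {xs = y ∷ ys} (here refl) = min≤⊤ y ys
∈⇒minimum≤ {xs = y ∷ ys} (there x∈)  = All.lookup (min≤xs y ys) x∈

-- The member `x` rules out the empty list, whose minimum is 0 by convention.
≤minimum : ∀ {v x xs} → x ∈ xs → (∀ {y} → y ∈ xs → v ≤ y) → v ≤ minimum xs
≤minimum {xs = y ∷ ys} _ v≤ = v≤min⁺ (v≤ (here refl)) (All.tabulate (v≤ ∘ there))

-- Degrees as weighted counts

∈-subsets : ∀ {n} (S : Subset n) → S ∈ subsets n
∈-subsets []            = here refl
∈-subsets (outside ∷ S) = ∈-++⁺ˡ (∈-map⁺ (outside ∷_) (∈-subsets S))
∈-subsets {suc n} (inside ∷ S) = ∈-++⁺ʳ (map (outside ∷_) (subsets n)) (∈-map⁺ (inside ∷_) (∈-subsets S))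

Σ⊆ : ∀ n → (Subset n → ℕ) → ℕ
Σ⊆ zero    f = f []
Σ⊆ (suc n) f = Σ⊆ n (f ∘ (outside ∷_)) + Σ⊆ n (f ∘ (inside ∷_))

Σ⊆-cong : ∀ n {f g} → (∀ e → f e ≡ g e) → Σ⊆ n f ≡ Σ⊆ n g
Σ⊆-cong zero    f≡g = f≡g []
Σ⊆-cong (suc n) f≡g = cong₂ _+_ (Σ⊆-cong n (f≡g ∘ (outside ∷_))) (Σ⊆-cong n (f≡g ∘ (inside ∷_)))

Σ⊆-zero : ∀ n {f} → (∀ e → f e ≡ 0) → Σ⊆ n f ≡ 0
Σ⊆-zero zero    f≡0 = f≡0 []
Σ⊆-zero (suc n) f≡0 = cong₂ _+_ (Σ⊆-zero n (f≡0 ∘ (outside ∷_))) (Σ⊆-zero n (f≡0 ∘ (inside ∷_)))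

length-filter-map : ∀ {A B : Set} {P : Pred B 0ℓ} (P? : Decidable P) (f : A → B) xs →
  length (filter P? (map f xs)) ≡ length (filter (P? ∘ f) xs)
length-filter-map P? f []       = refl
length-filter-map P? f (x ∷ xs) with does (P? (f x))
... | true  = cong suc (length-filter-map P? f xs)
... | false = length-filter-map P? f xs

length-filter-subsets : ∀ n {P : Pred (Subset n) 0ℓ} (P? : Decidable P) →
  length (filter P? (subsets n)) ≡ Σ⊆ n (λ e → 𝟙 (P? e))
length-filter-subsets zero P? with P? []
... | yes _ = refl
... | no _  = refl
length-filter-subsets (suc n) P? = begin
  length (filter P? (map (outside ∷_) (subsets n) ++ map (inside ∷_) (subsets n)))
    ≡⟨ cong length (filter-++ P? (map (outside ∷_) (subsets n)) _) ⟩
  length (filter P? (map (outside ∷_) (subsets n)) ++ filter P? (map (inside ∷_) (subsets n)))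
    ≡⟨ length-++ (filter P? (map (outside ∷_) (subsets n))) ⟩
  length (filter P? (map (outside ∷_) (subsets n))) + length (filter P? (map (inside ∷_) (subsets n)))
    ≡⟨ cong₂ _+_ (branch outside) (branch inside) ⟩
  Σ⊆ (suc n) (λ e → 𝟙 (P? e)) ∎
  where
  open ≡-Reasoning
  branch : ∀ v → length (filter P? (map (v ∷_) (subsets n))) ≡ Σ⊆ n (λ e → 𝟙 (P? (v ∷ e)))
  branch v = trans (length-filter-map P? (v ∷_) (subsets n)) (length-filter-subsets n (P? ∘ (v ∷_)))

-- Agrees with the test by which `deg` counts edges, except that an arbitrary `R` replaces the
-- congruence: a vertex of V₁ in the edge is then absorbed by passing to `R? ∘ suc`.
extends? : ∀ {R : ℕ → Set} (R? : Decidable R) {n} (S V : Subset n) k e → Dec ((∣ e ∣ ≡ k × R ∣ e ∩ V ∣) × S ⊆ e)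
extends? R? S V k e = ((∣ e ∣ ≟ k) ×-dec R? ∣ e ∩ V ∣) ×-dec (S ⊆? e)

cons⊆inside : ∀ {n} s {S e : Subset n} → S ⊆ e → s ∷ S ⊆ inside ∷ e
cons⊆inside outside = out⊆
cons⊆inside inside  = in⊆in

module _ {R : ℕ → Set} (R? : Decidable R) {n} (S V : Subset n) (k : ℕ) (e : Subset n) where

  extends-outside : ∀ v → 𝟙 (extends? R? (outside ∷ S) (v ∷ V) k (outside ∷ e)) ≡ 𝟙 (extends? R? S V k e)
  extends-outside v = 𝟙-cong (extends? R? (outside ∷ S) (v ∷ V) k (outside ∷ e)) (extends? R? S V k e)
    (λ (p , S⊆e) → p , drop-∷-⊆ S⊆e) (λ (p , S⊆e) → p , out⊆ S⊆e)

  extends-V₂ : ∀ s → 𝟙 (extends? R? (s ∷ S) (outside ∷ V) (suc k) (inside ∷ e)) ≡ 𝟙 (extends? R? S V k e)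
  extends-V₂ s = 𝟙-cong (extends? R? (s ∷ S) (outside ∷ V) (suc k) (inside ∷ e)) (extends? R? S V k e)
    (λ ((p , q) , S⊆e) → (suc-injective p , q) , drop-∷-⊆ S⊆e) (λ ((p , q) , S⊆e) → (cong suc p , q) , cons⊆inside s S⊆e)

  extends-V₁ : ∀ s → 𝟙 (extends? R? (s ∷ S) (inside ∷ V) (suc k) (inside ∷ e)) ≡ 𝟙 (extends? (R? ∘ suc) S V k e)
  extends-V₁ s = 𝟙-cong (extends? R? (s ∷ S) (inside ∷ V) (suc k) (inside ∷ e)) (extends? (R? ∘ suc) S V k e)
    (λ ((p , q) , S⊆e) → (suc-injective p , q) , drop-∷-⊆ S⊆e) (λ ((p , q) , S⊆e) → (cong suc p , q) , cons⊆inside s S⊆e)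

  no-extends-inside : ∀ v → 𝟙 (extends? R? (inside ∷ S) (v ∷ V) k (outside ∷ e)) ≡ 0
  no-extends-inside v = 𝟙-no (extends? R? (inside ∷ S) (v ∷ V) k (outside ∷ e))
    (λ (_ , S⊆e) → case S⊆e Vec.here of λ ())

  no-extends-small : ∀ v → k ≤ ∣ S ∣ → 𝟙 (extends? R? (outside ∷ S) (v ∷ V) k (inside ∷ e)) ≡ 0
  no-extends-small v k≤∣S∣ = 𝟙-no (extends? R? (outside ∷ S) (v ∷ V) k (inside ∷ e))
    (λ ((p , _) , S⊆e) → <⇒≱ (≤-trans (≤-reflexive p) k≤∣S∣) (p⊆q⇒∣p∣≤∣q∣ (drop-∷-⊆ S⊆e)))

-- By induction on the vertices: one in S is forced into the edge and at most shifts the count, one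
-- outside S is a free point of V₁ or V₂.
count-extensions : ∀ {n} (S V : Subset n) r {R : ℕ → Set} (R? : Decidable R) →
  Σ⊆ n (λ e → 𝟙 (extends? R? S V (∣ S ∣ + r) e))
  ≡ Sel ∣ V ∩ ∁ S ∣ ∣ ∁ V ∩ ∁ S ∣ r (λ t → 𝟙 (R? (∣ S ∩ V ∣ + t)))
count-extensions [] [] zero R? = trans
  (𝟙-cong (extends? R? [] [] 0 []) (R? 0) (λ ((_ , p) , _) → p) (λ p → (refl , p) , id))
  (sym (+-identityʳ (𝟙 (R? 0))))
count-extensions [] [] (suc r) R? = 𝟙-no (extends? R? [] [] (suc r) []) (λ { ((() , _) , _) })
count-extensions {suc n} (outside ∷ S) (v ∷ V) zero R? = trans
  (cong₂ _+_ (trans (Σ⊆-cong n (λ e → extends-outside R? S V (∣ S ∣ + 0) e v)) (count-extensions S V 0 R?))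
    (Σ⊆-zero n (λ e → no-extends-small R? S V (∣ S ∣ + 0) e v (≤-reflexive (+-identityʳ ∣ S ∣)))))
  (trans (+-identityʳ _) (trans (Sel-zero ∣ V ∩ ∁ S ∣ ∣ ∁ V ∩ ∁ S ∣ w) (trans
    (cong (λ x → 𝟙 (R? (x + 0))) (∣S∩V∣ v)) (sym (Sel-zero ∣ (v ∷ V) ∩ ∁ (outside ∷ S) ∣ ∣ ∁ (v ∷ V) ∩ ∁ (outside ∷ S) ∣ w′)))))
  where
  w = λ t → 𝟙 (R? (∣ S ∩ V ∣ + t))
  w′ = λ t → 𝟙 (R? (∣ (outside ∷ S) ∩ (v ∷ V) ∣ + t))
  ∣S∩V∣ : ∀ v → ∣ S ∩ V ∣ ≡ ∣ (outside ∷ S) ∩ (v ∷ V) ∣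
  ∣S∩V∣ v = refl
count-extensions {suc n} (outside ∷ S) (outside ∷ V) (suc r) R? = trans
  (cong₂ _+_
    (trans (Σ⊆-cong n (λ e → extends-outside R? S V (∣ S ∣ + suc r) e outside)) (count-extensions S V (suc r) R?))
    (trans (Σ⊆-cong n (λ e → trans (cong (λ k → 𝟙 (extends? R? (outside ∷ S) (outside ∷ V) k (inside ∷ e))) (+-suc ∣ S ∣ r))
      (extends-V₂ R? S V (∣ S ∣ + r) e outside))) (count-extensions S V r R?)))
  (sym (Sel-sucʳ ∣ V ∩ ∁ S ∣ ∣ ∁ V ∩ ∁ S ∣ r _))
count-extensions {suc n} (outside ∷ S) (inside ∷ V) (suc r) R? =
  cong₂ _+_
    (trans (Σ⊆-cong n (λ e → extends-outside R? S V (∣ S ∣ + suc r) e inside)) (count-extensions S V (suc r) R?))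
    (trans (Σ⊆-cong n (λ e → trans (cong (λ k → 𝟙 (extends? R? (outside ∷ S) (inside ∷ V) k (inside ∷ e))) (+-suc ∣ S ∣ r))
      (extends-V₁ R? S V (∣ S ∣ + r) e outside))) (trans (count-extensions S V r (R? ∘ suc))
        (Sel-cong ∣ V ∩ ∁ S ∣ ∣ ∁ V ∩ ∁ S ∣ r (λ t → cong (λ x → 𝟙 (R? x)) (sym (+-suc ∣ S ∩ V ∣ t))))))
count-extensions {suc n} (inside ∷ S) (outside ∷ V) r R? = cong₂ _+_
  (Σ⊆-zero n (λ e → no-extends-inside R? S V (suc ∣ S ∣ + r) e outside))
  (trans (Σ⊆-cong n (λ e → extends-V₂ R? S V (∣ S ∣ + r) e inside)) (count-extensions S V r R?))
count-extensions {suc n} (inside ∷ S) (inside ∷ V) r R? = cong₂ _+_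
  (Σ⊆-zero n (λ e → no-extends-inside R? S V (suc ∣ S ∣ + r) e inside))
  (trans (Σ⊆-cong n (λ e → extends-V₁ R? S V (∣ S ∣ + r) e inside)) (count-extensions S V r (R? ∘ suc)))

deg-congruenceGraph : ∀ {n} ℓ j r (S V : Subset n) →
  deg (congruenceGraph (∣ S ∣ + r) ℓ j V) S
  ≡ Sel ∣ V ∩ ∁ S ∣ ∣ ∁ V ∩ ∁ S ∣ r (λ t → residue (2 + ℓ) j (∣ S ∩ V ∣ + t))
deg-congruenceGraph {n} ℓ j r S V = trans
  (length-filter-subsets n (extends? R? S V (∣ S ∣ + r)))
  (count-extensions S V r R?)
  where
  R? = λ t → t ≋? j [mod 2 + ℓ ]

∣V∩∁S∣+∣S∩V∣≡∣V∣ : ∀ {n} (S V : Subset n) → ∣ V ∩ ∁ S ∣ + ∣ S ∩ V ∣ ≡ ∣ V ∣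
∣V∩∁S∣+∣S∩V∣≡∣V∣ []            []            = refl
∣V∩∁S∣+∣S∩V∣≡∣V∣ (outside ∷ S) (outside ∷ V) = ∣V∩∁S∣+∣S∩V∣≡∣V∣ S V
∣V∩∁S∣+∣S∩V∣≡∣V∣ (outside ∷ S) (inside ∷ V)  = cong suc (∣V∩∁S∣+∣S∩V∣≡∣V∣ S V)
∣V∩∁S∣+∣S∩V∣≡∣V∣ (inside ∷ S)  (outside ∷ V) = ∣V∩∁S∣+∣S∩V∣≡∣V∣ S V
∣V∩∁S∣+∣S∩V∣≡∣V∣ (inside ∷ S)  (inside ∷ V)  = trans (+-suc ∣ V ∩ ∁ S ∣ ∣ S ∩ V ∣) (cong suc (∣V∩∁S∣+∣S∩V∣≡∣V∣ S V))

∣V∣≤∣V∩∁S∣+∣S∣ : ∀ {n} (S V : Subset n) → ∣ V ∣ ≤ ∣ V ∩ ∁ S ∣ + ∣ S ∣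
∣V∣≤∣V∩∁S∣+∣S∣ S V = ≤-trans (≤-reflexive (sym (∣V∩∁S∣+∣S∩V∣≡∣V∣ S V))) (+-monoʳ-≤ ∣ V ∩ ∁ S ∣ (∣p∩q∣≤∣p∣ S V))

subset-meeting : ∀ {n} (V : Subset n) a b → a ≤ ∣ V ∣ → b ≤ ∣ ∁ V ∣ →
  ∃[ S ] (∣ S ∣ ≡ a + b × ∣ S ∩ V ∣ ≡ a)
subset-meeting [] zero zero _ _ = [] , refl , refl
subset-meeting (inside ∷ V) zero b a≤ b≤ with subset-meeting V zero b z≤n b≤
... | S , p , q = outside ∷ S , p , q
subset-meeting (inside ∷ V) (suc a) b (s≤s a≤) b≤ with subset-meeting V a b a≤ b≤
... | S , p , q = inside ∷ S , cong suc p , cong suc q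
subset-meeting (outside ∷ V) a zero a≤ b≤ with subset-meeting V a zero a≤ z≤n
... | S , p , q = outside ∷ S , p , q
subset-meeting (outside ∷ V) a (suc b) a≤ (s≤s b≤) with subset-meeting V a b a≤ b≤
... | S , p , q = inside ∷ S , trans (cong suc p) (sym (+-suc a b)) , q

∣initialSegment∣ : ∀ {n} s → s ≤ n → ∣ initialSegment {n} s ∣ ≡ s
∣initialSegment∣ {zero}  zero    z≤n = refl
∣initialSegment∣ {suc n} zero    z≤n = ∣initialSegment∣ {n} zero z≤n
∣initialSegment∣ {suc n} (suc s) (s≤s s≤n) = cong suc (∣initialSegment∣ {n} s s≤n)

module _ {n s} (s≤n : s ≤ n) where

  private
    V₁ : Subset n
    V₁ = initialSegment s

    ∣V₁∣ : ∣ V₁ ∣ ≡ s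
    ∣V₁∣ = ∣initialSegment∣ s s≤n

    ∣V₂∣ : ∣ ∁ V₁ ∣ ≡ n ∸ s
    ∣V₂∣ = trans (∣∁p∣≡n∸∣p∣ V₁) (cong (n ∸_) ∣V₁∣)

  -- Some d-set has `a` vertices in V₁ and `b` in V₂, and its degree bounds the minimum. Letting the
  -- `r` further points range over all of V only increases the count.
  δ-H≤Sel : ∀ {k d} ℓ j r a b → k ≡ d + r → a + b ≡ d → a ≤ s → b ≤ n ∸ s →
    δ d (H n k ℓ j s) ≤ Sel s (n ∸ s) r (λ t → residue (2 + ℓ) j (a + t))
  δ-H≤Sel ℓ j r a b refl refl a≤s b≤n∸s
    with subset-meeting V₁ a b (≤-trans a≤s (≤-reflexive (sym ∣V₁∣))) (≤-trans b≤n∸s (≤-reflexive (sym ∣V₂∣)))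
  ... | S , ∣S∣ , ∣S∩V₁∣ = begin
    δ (a + b) (H n (a + b + r) ℓ j s)
      ≤⟨ ∈⇒minimum≤ (∈-map⁺ (deg (H n (a + b + r) ℓ j s)) (∈-filter⁺ (λ S → ∣ S ∣ ≟ a + b) (∈-subsets S) ∣S∣)) ⟩
    deg (H n (a + b + r) ℓ j s) S
      ≡⟨ cong (λ d → deg (H n (d + r) ℓ j s) S) ∣S∣ ⟨
    deg (H n (∣ S ∣ + r) ℓ j s) S
      ≡⟨ deg-congruenceGraph ℓ j r S V₁ ⟩
    Sel ∣ V₁ ∩ ∁ S ∣ ∣ ∁ V₁ ∩ ∁ S ∣ r (λ t → residue (2 + ℓ) j (∣ S ∩ V₁ ∣ + t))
      ≤⟨ Sel-monoˡʳ r _ (≤-trans (∣p∩q∣≤∣p∣ V₁ (∁ S)) (≤-reflexive ∣V₁∣)) (≤-trans (∣p∩q∣≤∣p∣ (∁ V₁) (∁ S)) (≤-reflexive ∣V₂∣)) ⟩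
    Sel s (n ∸ s) r (λ t → residue (2 + ℓ) j (∣ S ∩ V₁ ∣ + t))
      ≡⟨ cong (λ i → Sel s (n ∸ s) r (λ t → residue (2 + ℓ) j (i + t))) ∣S∩V₁∣ ⟩
    Sel s (n ∸ s) r (λ t → residue (2 + ℓ) j (a + t)) ∎
    where open ≤-Reasoning

  -- Whatever d-set is removed, at least `M` vertices remain on each side.
  ≤δ-H : ∀ {k d} ℓ j r M μ → k ≡ d + r → M + d ≤ s → M + d ≤ n ∸ s →
    (∀ i → μ ≤ Sel M M r (λ t → residue (2 + ℓ) j (i + t))) → μ ≤ δ d (H n k ℓ j s)
  ≤δ-H {d = d} ℓ j r M μ refl M+d≤s M+d≤n∸s μ≤ =
    ≤minimum (∈-map⁺ (deg G) (∈-filter⁺ size? (∈-subsets S₀) ∣S₀∣)) λ {y} y∈ → bound y∈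
    where
    open ≤-Reasoning
    G = H n (d + r) ℓ j s
    size? = λ (S : Subset n) → ∣ S ∣ ≟ d
    -- A d-set has to be exhibited, or the minimum could be the default 0.
    d-set : ∃[ S ] (∣ S ∣ ≡ d + 0 × ∣ S ∩ V₁ ∣ ≡ d)
    d-set = subset-meeting V₁ d 0 (≤-trans (≤-trans (m≤n+m d M) M+d≤s) (≤-reflexive (sym ∣V₁∣))) z≤n
    S₀ = proj₁ d-set
    ∣S₀∣ : ∣ S₀ ∣ ≡ d
    ∣S₀∣ = trans (proj₁ (proj₂ d-set)) (+-identityʳ d)
    remains : ∀ V x S → ∣ S ∣ ≡ d → ∣ V ∣ ≡ x → M + d ≤ x → M ≤ ∣ V ∩ ∁ S ∣
    remains V x S refl refl M+d≤x = +-cancelʳ-≤ d _ _ (≤-trans M+d≤x (∣V∣≤∣V∩∁S∣+∣S∣ S V))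
    degree : ∀ S → ∣ S ∣ ≡ d → μ ≤ deg G S
    degree S ∣S∣ = begin
      μ ≤⟨ μ≤ ∣ S ∩ V₁ ∣ ⟩
      Sel M M r w
        ≤⟨ Sel-monoˡʳ r w (remains V₁ s S ∣S∣ ∣V₁∣ M+d≤s) (remains (∁ V₁) (n ∸ s) S ∣S∣ ∣V₂∣ M+d≤n∸s) ⟩
      Sel ∣ V₁ ∩ ∁ S ∣ ∣ ∁ V₁ ∩ ∁ S ∣ r w
        ≡⟨ deg-congruenceGraph ℓ j r S V₁ ⟨
      deg (H n (∣ S ∣ + r) ℓ j s) S
        ≡⟨ cong (λ d → deg (H n (d + r) ℓ j s) S) ∣S∣ ⟩
      deg G S ∎
      where w = λ t → residue (2 + ℓ) j (∣ S ∩ V₁ ∣ + t)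
    bound : ∀ {y} → y ∈ map (deg G) (filter size? (subsets n)) → μ ≤ y
    bound y∈ with ∈-map⁻ (deg G) y∈
    ... | S , S∈ , refl = degree S (proj₂ (∈-filter⁻ size? {xs = subsets n} S∈))

-- Admissible sizes and parts with few vertices

Admissible : (n k ℓ j s : ℕ) → .{{NonZero k}} → Set
Admissible n k ℓ j s = s ≋ (n ℕ./ k) * j + ℓ + 1 [mod 2 + ℓ ]

module _ {k d ℓ n : ℕ} .{{_ : NonZero k}} where

  private
    δs : ℕ → ℕ → ℕ
    δs j s = δ d (H n k ℓ j s)

    adm? = λ j s → s ≋? (n ℕ./ k) * j + ℓ + 1 [mod 2 + ℓ ]

  maxδ-elim : ∀ (P : ℕ → Set) → P 0 →
    (∀ j s → j < 2 + ℓ → s ≤ n → Admissible n k ℓ j s → P (δ d (H n k ℓ j s))) → P (maxδ k d ℓ n)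
  maxδ-elim P P0 Pδ =
    maximum-elim P (λ j → maximum (map (δs j) (admissible n k ℓ j))) (upTo (2 + ℓ)) P0 λ {j} j∈ →
    maximum-elim P (δs j) (admissible n k ℓ j) P0 λ {s} s∈ →
    let s∈upTo , adm = ∈-filter⁻ (adm? j) {xs = upTo (suc n)} s∈
    in Pδ j s (∈-upTo⁻ j∈) (s≤s⁻¹ (∈-upTo⁻ s∈upTo)) adm

  δ≤maxδ : ∀ j s → j < 2 + ℓ → s ≤ n → Admissible n k ℓ j s → δ d (H n k ℓ j s) ≤ maxδ k d ℓ n
  δ≤maxδ j s j< s≤n adm = ≤-trans
    (∈⇒≤maximum (∈-map⁺ (δs j) (∈-filter⁺ (adm? j) (∈-upTo⁺ (s≤s s≤n)) adm)))
    (∈⇒≤maximum (∈-map⁺ (λ j → maximum (map (δs j) (admissible n k ℓ j))) (∈-upTo⁺ j<)))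

≋-suc : ∀ ℓ t → ¬ (t ≋ suc t [mod 2 + ℓ ])
≋-suc ℓ t = %-shift-injective (2 + ℓ) {0} {1} t (s≤s z≤n) (s≤s (s≤s z≤n))

-- The modulus is at least 2. Hence, of two d-sets whose intersections with V₁ differ by one vertex,
-- one has the wrong residue.
residue-adjacent : ∀ ℓ j t → residue (2 + ℓ) j t ≡ 0 ⊎ residue (2 + ℓ) j (suc t) ≡ 0
residue-adjacent ℓ j t with t ≋? j [mod 2 + ℓ ]
... | no _  = inj₁ refl
... | yes p = inj₂ (𝟙-no (suc t ≋? j [mod 2 + ℓ ]) (λ q → ≋-suc ℓ t (trans p (sym q))))

module _ {k ℓ n : ℕ} .{{_ : NonZero k}} {j : ℕ} where

  -- When V₁ is empty or everything, a k-set is an edge or not regardless of the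
  -- choice of its elements; the congruence imposed on xn forces "not".
  V₁-empty : j < 2 + ℓ → Admissible n k ℓ j 0 → residue (2 + ℓ) j 0 ≡ 0
  V₁-empty j<2+ℓ adm = 𝟙-no (0 ≋? j [mod m ]) λ 0≋j → 0≢1+n (begin
    0                    ≡⟨ adm ⟩
    (q * j + ℓ + 1) % m  ≡⟨ cong (λ j → (q * j + ℓ + 1) % m) (trans 0≋j (m<n⇒m%n≡m j<2+ℓ)) ⟨
    (q * 0 + ℓ + 1) % m  ≡⟨ cong (λ x → (x + ℓ + 1) % m) (*-zeroʳ q) ⟩
    (ℓ + 1) % m          ≡⟨ cong (_% m) (+-comm ℓ 1) ⟩
    suc ℓ % m            ≡⟨ m<n⇒m%n≡m ≤-refl ⟩
    suc ℓ                ∎)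
    where
    open ≡-Reasoning
    m = 2 + ℓ
    q = n ℕ./ k

  -- With q = n / k we have n = qk + ℓ, so k ≡ j would give n ≡ qj + ℓ, one less than admissibility
  -- prescribes.
  V₁-full : n ≋ ℓ [mod k ] → ℓ < k → Admissible n k ℓ j n → residue (2 + ℓ) j k ≡ 0
  V₁-full n≋ℓ ℓ<k adm = 𝟙-no (k ≋? j [mod m ]) λ k≋j → ≋-suc ℓ (q * j + ℓ) (begin
    (q * j + ℓ) % m                ≡⟨ %-distribˡ-+ (q * j) ℓ m ⟩
    ((q * j) % m + ℓ % m) % m      ≡⟨ cong (λ x → (x + ℓ % m) % m) (*-cong k≋j) ⟨
    ((q * k) % m + ℓ % m) % m      ≡⟨ %-distribˡ-+ (q * k) ℓ m ⟨
    (q * k + ℓ) % m                ≡⟨ cong (_% m) (+-comm (q * k) ℓ) ⟩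
    (ℓ + q * k) % m                ≡⟨ cong (λ x → (x + q * k) % m) (trans n≋ℓ (m<n⇒m%n≡m ℓ<k)) ⟨
    (n % k + q * k) % m            ≡⟨ cong (_% m) (m≡m%n+[m/n]*n n k) ⟨
    n % m                          ≡⟨ adm ⟩
    (q * j + ℓ + 1) % m            ≡⟨ cong (_% m) (+-comm (q * j + ℓ) 1) ⟩
    suc (q * j + ℓ) % m            ∎)
    where
    open ≡-Reasoning
    m = 2 + ℓ
    q = n ℕ./ k
    *-cong : k ≋ j [mod m ] → (q * k) % m ≡ (q * j) % m
    *-cong k≋j = trans (%-distribˡ-* q k m) (trans (cong (λ x → ((q % m) * x) % m) k≋j) (sym (%-distribˡ-* q j m)))

-- If V₁ or V₂ has fewer than d vertices, almost all k-sets through a d-set S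
-- meet V₁ in the same number of vertices, and this is a wrong one for some S.
δ-dichotomy : ∀ {k d ℓ n} .{{_ : NonZero k}} r j s → k ≡ d + suc r → 1 ≤ d → d + d ≤ n →
  n ≋ ℓ [mod k ] → ℓ < k → j < 2 + ℓ → s ≤ n → Admissible n k ℓ j s →
  δ d (H n k ℓ j s) ≤ d * (n C r) ⊎
  (∀ i → i ≤ d → δ d (H n k ℓ j s) ≤ Sel s (n ∸ s) (suc r) (λ t → residue (2 + ℓ) j (i + t)))
δ-dichotomy {k} {d} {ℓ} {n} r j s k≡ 1≤d 2d≤n n≋ℓ ℓ<k j< s≤n adm with d ≤? s | d ≤? n ∸ s
... | yes d≤s | yes d≤n∸s = inj₂ λ i i≤d →
  δ-H≤Sel s≤n ℓ j (suc r) i (d ∸ i) k≡ (m+[n∸m]≡n i≤d) (≤-trans i≤d d≤s) (≤-trans (m∸n≤m d i) d≤n∸s)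
... | no d≰s | _ = inj₁ (few (choice s refl))
  where
  s<d = ≰⇒> d≰s
  m = 2 + ℓ
  d≤n∸s : d ≤ n ∸ s
  d≤n∸s = m+n≤o⇒m≤o∸n d (≤-trans (+-monoʳ-≤ d (<⇒≤ s<d)) 2d≤n)
  -- Almost all extensions add no vertex of V₁, so i + 0 decides. One vertex of V₁ suffices to
  -- choose between i = 0 and i = 1.
  choice : ∀ s′ → s ≡ s′ → ∃[ i ] (i ≤ s × residue m j (i + 0) ≡ 0)
  choice zero     s≡0 = 0 , z≤n , V₁-empty {k} {ℓ} {n} j< (trans (cong (_% m) (sym s≡0)) adm)
  choice (suc s′) refl with residue-adjacent ℓ j 0
  ... | inj₁ p = 0 , z≤n , p
  ... | inj₂ p = 1 , s≤s z≤n , p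
  few : ∃[ i ] (i ≤ s × residue m j (i + 0) ≡ 0) → δ d (H n k ℓ j s) ≤ d * (n C r)
  few (i , i≤s , w0) = begin
    δ d (H n k ℓ j s)
      ≤⟨ δ-H≤Sel s≤n ℓ j (suc r) i (d ∸ i) k≡ (m+[n∸m]≡n (≤-trans i≤s (<⇒≤ s<d))) i≤s (≤-trans (m∸n≤m d i) d≤n∸s) ⟩
    Sel s (n ∸ s) (suc r) (λ t → residue m j (i + t))
      ≤⟨ Sel-fewˡ s (n ∸ s) r (λ t → residue≤1 m j (i + t)) w0 ⟩
    s * ((s + (n ∸ s)) C r)  ≡⟨ cong (λ x → s * (x C r)) (m+[n∸m]≡n s≤n) ⟩
    s * (n C r)              ≤⟨ *-monoˡ-≤ (n C r) (<⇒≤ s<d) ⟩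
    d * (n C r)              ∎
    where open ≤-Reasoning
... | yes d≤s | no d≰n∸s = inj₁ (few (choice d 1≤d refl (n ∸ s) refl))
  where
  u<d = ≰⇒> d≰n∸s
  m = 2 + ℓ
  Choice = ∃[ i ] (i ≤ d × d ∸ i ≤ n ∸ s × residue m j (i + suc r) ≡ 0)
  -- Now almost all extensions lie inside V₁, so i + r + 1 decides. The value i = d - 1 costs one
  -- vertex of V₂; if there is none, i = d gives k.
  choice : ∀ d′ → 1 ≤ d′ → d ≡ d′ → ∀ u → n ∸ s ≡ u → Choice
  choice (suc d′) _ refl zero    u≡0 = suc d′ , ≤-refl , ≤-trans (≤-reflexive (n∸n≡0 d)) z≤n ,
    subst (λ x → residue m j x ≡ 0) k≡ (V₁-full {k} {ℓ} {n} n≋ℓ ℓ<k (trans (cong (_% m) n≡s) adm))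
    where
    n≡s : n ≡ s
    n≡s = ≤-antisym (m∸n≡0⇒m≤n u≡0) s≤n
  choice (suc d′) _ refl (suc u) u≡ with residue-adjacent ℓ j (d′ + suc r)
  ... | inj₁ p = d′ , n≤1+n d′ , subst₂ _≤_ (sym (m+n∸n≡m 1 d′)) (sym u≡) (s≤s z≤n) , p
  ... | inj₂ p = suc d′ , ≤-refl , ≤-trans (≤-reflexive (n∸n≡0 d)) z≤n , p
  few : Choice → δ d (H n k ℓ j s) ≤ d * (n C r)
  few (i , i≤d , d∸i≤u , wr) = begin
    δ d (H n k ℓ j s)
      ≤⟨ δ-H≤Sel s≤n ℓ j (suc r) i (d ∸ i) k≡ (m+[n∸m]≡n i≤d) (≤-trans i≤d d≤s) d∸i≤u ⟩
    Sel s (n ∸ s) (suc r) (λ t → residue m j (i + t))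
      ≤⟨ Sel-fewʳ s (n ∸ s) r (λ t → residue≤1 m j (i + t)) wr ⟩
    (n ∸ s) * ((s + (n ∸ s)) C r)  ≡⟨ cong (λ x → (n ∸ s) * (x C r)) (m+[n∸m]≡n s≤n) ⟩
    (n ∸ s) * (n C r)              ≤⟨ *-monoˡ-≤ (n C r) (<⇒≤ u<d) ⟩
    d * (n C r)                    ∎
    where open ≤-Reasoning

-- Upper bounds at finite n

module _ {k d ℓ} .{{_ : NonZero k}} (r m : ℕ) (k≡ : k ≡ d + suc r) (ℓ<k : ℓ < k)
         (n≋ℓ : (d + m) ≋ ℓ [mod k ]) where

  private
    n = d + m
    -- Here k - d is `suc r` and n - d is `m`, so `B` is the denominator of the density. `E` has
    -- order m^r and dominates every error term below.
    B = m C suc r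
    E = (suc r + d + m) C r

    nCr≤E : n C r ≤ E
    nCr≤E = C-mono r (≤-trans (m≤n+m n (suc r)) (≤-reflexive (sym (+-assoc (suc r) d m))))

  -- The e + 1 values i = 0, ..., e occur as e ≤ d, and their classes are disjoint as e + 1 ≤ ℓ + 2.
  -- Taking e = d and e = ℓ + 1 gives the two halves of (i).
  maxδ-average : ∀ e → 1 ≤ d → d ≤ m → e ≤ d → e ≤ suc ℓ →
    suc e * maxδ k d ℓ n ≤ 1 * B + (suc e * d + d) * E
  maxδ-average e 1≤d d≤m e≤d e≤1+ℓ = maxδ-elim {k} {d} {ℓ} {n} P (≤-trans (≤-reflexive (*-zeroʳ (suc e))) z≤n)
    λ j s j< s≤n adm → either j s s≤n (δ-dichotomy r j s k≡ 1≤d (+-monoʳ-≤ d d≤m) n≋ℓ ℓ<k j< s≤n adm)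
    where
    open ≤-Reasoning
    P : ℕ → Set
    P x = suc e * x ≤ 1 * B + (suc e * d + d) * E
    split : ∀ e d B E → (1 + e) * (d * E) + (1 * B + d * E) ≡ 1 * B + ((1 + e) * d + d) * E
    split = solve-∀
    either : ∀ j s → s ≤ n → _ ⊎ _ → P (δ d (H n k ℓ j s))
    either j s s≤n (inj₁ δ≤) = begin
      suc e * δ d (H n k ℓ j s)              ≤⟨ *-monoʳ-≤ (suc e) (≤-trans δ≤ (*-monoʳ-≤ d nCr≤E)) ⟩
      suc e * (d * E)                        ≤⟨ m≤m+n _ (1 * B + d * E) ⟩
      suc e * (d * E) + (1 * B + d * E)      ≡⟨ split e d B E ⟩
      1 * B + (suc e * d + d) * E            ∎
    either j s s≤n (inj₂ δ≤) = begin
      suc e * δ d (H n k ℓ j s)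
        ≤⟨ Sel-average (2 + ℓ) j s (n ∸ s) (suc r) (suc e) _ (s≤s e≤1+ℓ) (λ i i<1+e → δ≤ i (≤-trans (s≤s⁻¹ i<1+e) e≤d)) ⟩
      (s + (n ∸ s)) C suc r                  ≡⟨ cong (_C suc r) (m+[n∸m]≡n s≤n) ⟩
      n C suc r                              ≤⟨ C-+-error d m r ⟩
      B + d * (n C r)                        ≤⟨ +-mono-≤ (≤-reflexive (sym (*-identityˡ B))) (*-monoʳ-≤ d nCr≤E) ⟩
      1 * B + d * E                          ≤⟨ m≤n+m _ (suc e * (d * E)) ⟩
      suc e * (d * E) + (1 * B + d * E)      ≡⟨ split e d B E ⟩
      1 * B + (suc e * d + d) * E            ∎

  -- The ratio p / (u + 1) is (2^R - 1)/(3 · 2^R) with R = k - d, just below 1/3. As d ≥ 2, the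
  -- values i = 0, 1, 2 cover all residues modulo 3, and `Tup-min` applies to the tuples.
  maxδ-strict : ∀ p u → 2 ^ suc r ≡ suc p → suc u ≡ 3 * suc p → ℓ ≡ 1 → 2 ≤ d → d ≤ m →
    suc u * maxδ k d ℓ n ≤ p * B + (suc u * d + p * (suc r + d)) * E
  maxδ-strict p u 2^R≡ u≡ refl 2≤d d≤m = maxδ-elim {k} {d} {ℓ} {n} P (≤-trans (≤-reflexive (*-zeroʳ (suc u))) z≤n)
    λ j s j< s≤n adm → either j s s≤n (δ-dichotomy r j s k≡ (<⇒≤ 2≤d) (+-monoʳ-≤ d d≤m) n≋ℓ ℓ<k j< s≤n adm)
    where
    open ≤-Reasoning
    R = suc r
    P : ℕ → Set
    P x = suc u * x ≤ p * B + (suc u * d + p * (suc r + d)) * E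
    split : ∀ q p c d B E → q * (d * E) + p * (B + c * E) ≡ p * B + (q * d + p * c) * E
    split = solve-∀
    either : ∀ j s → s ≤ n → _ ⊎ _ → P (δ d (H n k ℓ j s))
    either j s s≤n (inj₁ δ≤) = begin
      suc u * δ d (H n k ℓ j s)                    ≤⟨ *-monoʳ-≤ (suc u) (≤-trans δ≤ (*-monoʳ-≤ d nCr≤E)) ⟩
      suc u * (d * E)                              ≤⟨ m≤m+n _ _ ⟩
      suc u * (d * E) + p * (B + (suc r + d) * E)  ≡⟨ split (suc u) p (suc r + d) d B E ⟩
      p * B + (suc u * d + p * (suc r + d)) * E    ∎
    either j s s≤n (inj₂ δ≤) = begin
      suc u * D                                    ≤⟨ *-cancelˡ-≤ (R !) {{R !≢0}} cancelled ⟩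
      p * ((R + n) C R)                            ≡⟨ cong (λ x → p * (x C R)) (sym (+-assoc R d m)) ⟩
      p * ((R + d + m) C R)                        ≤⟨ *-monoʳ-≤ p (C-+-error (R + d) m r) ⟩
      p * (B + (R + d) * E)                        ≤⟨ m≤n+m _ (suc u * (d * E)) ⟩
      suc u * (d * E) + p * (B + (suc r + d) * E)  ≡⟨ split (suc u) p (suc r + d) d B E ⟩
      p * B + (suc u * d + p * (suc r + d)) * E    ∎
      where
      D = δ d (H n k ℓ j s)
      w = residue 3 j
      scaled : ∀ i → i ≤ d → R ! * D ≤ Tup s (n ∸ s) R (λ t → w (i + t))
      scaled i i≤d = ≤-trans (*-monoʳ-≤ (R !) (δ≤ i i≤d)) (r!*Sel≤Tup s (n ∸ s) R _)
      commute : ∀ x y z → x * (y * z) ≡ y * (x * z)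
      commute = solve-∀
      tuples : 3 * 2 ^ R * (R ! * D) + (s + (n ∸ s)) ^ R ≤ 2 ^ R * (s + (n ∸ s)) ^ R
      tuples = Tup-min s (n ∸ s) R (R ! * D) (residue₃ j)
        (scaled 0 z≤n) (scaled 1 (<⇒≤ 2≤d)) (scaled 2 2≤d)
      tuples′ : suc u * (R ! * D) ≤ p * n ^ R
      tuples′ = +-cancelʳ-≤ (n ^ R) _ _ (≤-trans
        (subst (λ x → x * (R ! * D) + n ^ R ≤ suc p * n ^ R) (sym u≡)
          (subst₂ (λ x y → 3 * x * (R ! * D) + y ^ R ≤ x * y ^ R) 2^R≡ (m+[n∸m]≡n s≤n) tuples))
        (≤-reflexive (+-comm (n ^ R) (p * n ^ R))))
      cancelled : R ! * (suc u * D) ≤ R ! * (p * ((R + n) C R))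
      cancelled = begin
        R ! * (suc u * D)          ≡⟨ commute (R !) (suc u) D ⟩
        suc u * (R ! * D)          ≤⟨ tuples′ ⟩
        p * n ^ R                  ≤⟨ *-monoʳ-≤ p (n^r≤r!*[n+r]Cr n R) ⟩
        p * (R ! * ((R + n) C R))  ≡⟨ commute p (R !) _ ⟩
        R ! * (p * ((R + n) C R))  ∎

-- Lower bound from a balanced partition

-- For ℓ = 1 and j = 0 the admissible sizes of V₁ are those congruent to 2 modulo 3.
two-mod-three : ∀ h → ∃[ τ ] (τ ≤ 2 × (h + τ) ≋ 2 [mod 3 ])
two-mod-three zero = 2 , ≤-refl , refl
two-mod-three (suc h) with two-mod-three h
... | suc τ , τ<2 , eq = τ , <⇒≤ τ<2 , trans (cong (_% 3) (sym (+-suc h τ))) eq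
... | zero  , _   , eq = 2 , ≤-refl , trans (trans (cong (_% 3) (three h)) ([m+n]%n≡m%n (h + 0) 3)) eq
  where
  three : ∀ h → 1 + h + 2 ≡ h + 0 + 3
  three = solve-∀

-- Both sides get at least M + d vertices, so `M` survive on each after deleting any d-set; `τ`
-- adjusts |V₁| to the congruence, with j = 0.
maxδ-balanced : ∀ {k d n} .{{_ : NonZero k}} R M τ → k ≡ d + R → τ ≤ 2 →
  (M + (d + 2) + τ) ≋ 2 [mod 3 ] → 2 * (d + 2) + (M + M) ≤ n →
  2 ^ R ℕ./ 3 * (M C R) ≤ maxδ k d 1 n
maxδ-balanced {k} {d} {n} R M τ k≡ τ≤2 s≋2 ≤n = begin
  2 ^ R ℕ./ 3 * (M C R)     ≤⟨ ≤δ-H s≤n 1 0 R M (2 ^ R ℕ./ 3 * (M C R)) k≡ M+d≤s (m+n≤o⇒m≤o∸n (M + d) M+d+s≤n) transversals ⟩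
  δ d (H n k 1 0 s)       ≤⟨ δ≤maxδ {k} {d} {1} {n} 0 s (s≤s z≤n) s≤n (trans s≋2 (cong (λ x → (x + 1 + 1) % 3) (sym (*-zeroʳ (n ℕ./ k))))) ⟩
  maxδ k d 1 n            ∎
  where
  open ≤-Reasoning
  s = M + (d + 2) + τ
  M+d≤s : M + d ≤ s
  M+d≤s = ≤-trans (+-monoʳ-≤ M (m≤m+n d 2)) (m≤m+n _ τ)
  regroup : ∀ M d → M + d + (M + (d + 2) + 2) ≡ 2 * (d + 2) + (M + M)
  regroup = solve-∀
  M+d+s≤n : M + d + s ≤ n
  M+d+s≤n = begin
    M + d + (M + (d + 2) + τ)                ≤⟨ +-monoʳ-≤ (M + d) (+-monoʳ-≤ (M + (d + 2)) τ≤2) ⟩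
    M + d + (M + (d + 2) + 2)                ≡⟨ regroup M d ⟩
    2 * (d + 2) + (M + M)                    ≤⟨ ≤n ⟩
    n                                        ∎
  s≤n : s ≤ n
  s≤n = m+n≤o⇒n≤o (M + d) M+d+s≤n
  shift : ∀ i {w} → Partition₃ w → Partition₃ (λ t → w (i + t))
  shift zero    pw = pw
  shift (suc i) pw = shift i (shift₃ pw)
  transversals : ∀ i → 2 ^ R ℕ./ 3 * (M C R) ≤ Sel M M R (λ t → residue 3 0 (i + t))
  transversals i = begin
    2 ^ R ℕ./ 3 * (M C R)     ≤⟨ *-monoˡ-≤ (M C R) (2^r/3≤Tup R (shift i (residue₃ 0))) ⟩
    Tup 1 1 R (λ t → residue 3 0 (i + t)) * (M C R) ≡⟨ *-comm _ (M C R) ⟩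
    (M C R) * Tup 1 1 R (λ t → residue 3 0 (i + t)) ≤⟨ Sel-transversals M R _ ⟩
    Sel M M R (λ t → residue 3 0 (i + t)) ∎

-- Dropping the `c` unpaired vertices and applying `2m-C` replaces C(m, R) by 2^R C(M, R), where R =
-- r + 1, at the price of terms of order m^r.
halving-error : ∀ f r d m M c {x} → d + m ≡ c + (M + M) → c ≤ 2 * d + 5 → f * (M C suc r) ≤ x →
  f * (m C suc r) ≤ 2 ^ suc r * x + f * (suc r + (2 * d + 5)) * ((suc r + d + m) C r)
halving-error f r d m M c {x} n≡ c≤ fX≤x = begin
  f * (m C R)                                    ≤⟨ *-monoʳ-≤ f (C-+-mono d m R) ⟩
  f * ((d + m) C R)                              ≡⟨ cong (λ x → f * (x C R)) n≡ ⟩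
  f * ((c + (M + M)) C R)                        ≤⟨ *-monoʳ-≤ f (C-+-error c (M + M) r) ⟩
  f * ((M + M) C R + c * ((c + (M + M)) C r))    ≤⟨ *-monoʳ-≤ f (+-mono-≤ (2m-C M r) (*-mono-≤ c≤ (C-mono r c+2M≤))) ⟩
  f * (2 ^ R * X + R * ((M + M) C r) + (2 * d + 5) * E)
    ≤⟨ *-monoʳ-≤ f (+-monoˡ-≤ ((2 * d + 5) * E) (+-monoʳ-≤ (2 ^ R * X) (*-monoʳ-≤ R (C-mono r (≤-trans (m≤n+m (M + M) c) c+2M≤))))) ⟩
  f * (2 ^ R * X + R * E + (2 * d + 5) * E)      ≡⟨ collect f (2 ^ R) X R (2 * d + 5) E ⟩
  2 ^ R * (f * X) + f * (R + (2 * d + 5)) * E    ≤⟨ +-monoˡ-≤ _ (*-monoʳ-≤ (2 ^ R) fX≤x) ⟩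
  2 ^ R * x + f * (R + (2 * d + 5)) * E          ∎
  where
  open ≤-Reasoning
  R = suc r
  X = M C R
  E = (R + d + m) C r
  collect : ∀ f p X R c E → f * (p * X + R * E + c * E) ≡ p * (f * X) + f * (R + c) * E
  collect = solve-∀
  c+2M≤ : c + (M + M) ≤ R + d + m
  c+2M≤ = ≤-trans (≤-reflexive (sym n≡)) (≤-trans (m≤n+m (d + m) R) (≤-reflexive (sym (+-assoc R d m))))

maxδ-half : ∀ {k d} .{{_ : NonZero k}} r m → k ≡ d + suc r → 2 * (d + 2) ≤ d + m →
  2 ^ suc r ℕ./ 3 * (m C suc r) ≤
  2 ^ suc r * maxδ k d 1 (d + m) + 2 ^ suc r ℕ./ 3 * (suc r + (2 * d + 5)) * ((suc r + d + m) C r)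
maxδ-half {k} {d} r m k≡ large =
  let τ , τ≤2 , s≋2 = two-mod-three (M + (d + 2))
  in halving-error (2 ^ suc r ℕ./ 3) r d m M c n≡ c≤
       (maxδ-balanced {k} {d} {d + m} (suc r) M τ k≡ τ≤2 s≋2
         (≤-trans (+-monoˡ-≤ (M + M) (m≤n+m (2 * (d + 2)) (n′ % 2))) (≤-reflexive (sym n≡))))
  where
  n′ = d + m ∸ 2 * (d + 2)
  M = n′ ℕ./ 2
  -- The parity bit plus the vertices reserved on the two sides: at most 1 + 2(d + 2) = 2d + 5.
  c = n′ % 2 + 2 * (d + 2)
  arrange : ∀ ρ M D → 2 * D + (ρ + M * 2) ≡ ρ + 2 * D + (M + M)
  arrange = solve-∀
  n≡ : d + m ≡ c + (M + M)
  n≡ = trans (sym (m+[n∸m]≡n large)) (trans (cong (λ x → 2 * (d + 2) + x) (m≡m%n+[m/n]*n n′ 2)) (arrange (n′ % 2) M (d + 2)))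
  c≤ : c ≤ 2 * d + 5
  c≤ = ≤-trans (+-monoˡ-≤ (2 * (d + 2)) (s≤s⁻¹ (m%n<n n′ 2))) (≤-reflexive (five d))
    where
    five : ∀ d → 1 + 2 * (d + 2) ≡ 2 * d + 5
    five = solve-∀

-- From integer inequalities to densities

toℚᵘ-/ : ∀ x b → toℚᵘ (+ x / suc b) ℚᵘ.≃ mkℚᵘ (+ x) b
toℚᵘ-/ x b = ℚ.toℚᵘ-fromℚᵘ (mkℚᵘ (+ x) b)

toℚᵘ-+-/ : ∀ v u e → toℚᵘ (+ v / suc u ℚ.+ e) ℚᵘ.≃ mkℚᵘ (+ v) u ℚᵘ.+ toℚᵘ e
toℚᵘ-+-/ v u e = ℚᵘ.≃-trans (ℚ.toℚᵘ-homo-+ (+ v / suc u) e) (ℚᵘ.+-congˡ (toℚᵘ e) (toℚᵘ-/ v u))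

numerator-+ : ∀ v u p a → + (v * suc a + p * suc u) ≡ + v ℤ.* + suc a ℤ.+ + p ℤ.* + suc u
numerator-+ v u p a = trans (ℤ.pos-+ (v * suc a) (p * suc u)) (cong₂ ℤ._+_ (ℤ.pos-* v (suc a)) (ℤ.pos-* p (suc u)))

/-≤-/+ : ∀ x b v u p a .(c : Coprime p (suc a)) → x * (suc u * suc a) ≤ (v * suc a + p * suc u) * suc b →
  + x / suc b ℚ.≤ + v / suc u ℚ.+ mkℚ (+ p) a c
/-≤-/+ x b v u p a c le = ℚ.toℚᵘ-cancel-≤
  (ℚᵘ.≤-respˡ-≃ (ℚᵘ.≃-sym (toℚᵘ-/ x b)) (ℚᵘ.≤-respʳ-≃ (ℚᵘ.≃-sym (toℚᵘ-+-/ v u (mkℚ (+ p) a c)))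
    (ℚᵘ.*≤* (subst₂ ℤ._≤_ (ℤ.pos-* x (suc u * suc a))
      (trans (ℤ.pos-* (v * suc a + p * suc u) (suc b)) (cong (ℤ._* + suc b) (numerator-+ v u p a))) (ℤ.+≤+ le)))))

½*p+½*p≡p : ∀ p → ½ ℚ.* p ℚ.+ ½ ℚ.* p ≡ p
½*p+½*p≡p p = trans (sym (ℚ.*-distribʳ-+ p ½ ½)) (ℚ.*-identityˡ p)

halve : ∀ ε → 0ℚ ℚ.< ε → ∃[ h ] (0ℚ ℚ.< h × h ℚ.+ h ≡ ε)
halve ε 0<ε = ½ ℚ.* ε , subst (ℚ._< ½ ℚ.* ε) (ℚ.*-zeroʳ ½) (ℚ.*-monoʳ-<-pos ½ 0<ε) , ½*p+½*p≡p ε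

-- The target density is `v / suc u`, `K` multiplies the error binomial, and the estimate is assumed
-- for m ≥ `N₀`.
module _ {k d ℓ : ℕ} .{{_ : NonZero k}} (r : ℕ) (k≡ : k ≡ d + suc r) (u v K N₀ : ℕ) where

  private
    B E : ℕ → ℕ
    B m = m C suc r
    E m = (suc r + d + m) C r

    density≡ : ∀ m → density k d ℓ (d + m) ≡ ratio (maxδ k d ℓ (d + m)) (B m)
    density≡ m = cong₂ (λ x y → ratio (maxδ k d ℓ (d + m)) (x C y)) (m+n∸m≡n d m)
      (trans (cong (_∸ d) k≡) (m+n∸m≡n d (suc r)))

    threshold : ℕ → ℕ
    -- The middle summand meets the hypothesis of `C-dominates`, and the last `suc r` makes the
    -- denominator positive.
    threshold A = d + (N₀ + (suc r * (suc r + d + A * K) + r) + suc r)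

    beyond : ∀ A (Q : ℕ → Set) →
      (∀ m → N₀ ≤ m → 1 ≤ B m → A * K * E m ≤ B m → Q (d + m)) → ∀ n → threshold A ≤ n → Q n
    beyond A Q Qm n N≤n with m≤n⇒∃[o]m+o≡n (m+n≤o⇒m≤o d N≤n)
    ... | m , refl = Qm m (m+n≤o⇒m≤o N₀ (m+n≤o⇒m≤o _ N≤m))
      (C-positive (suc r) m (m+n≤o⇒n≤o _ N≤m))
      (C-dominates (A * K) (suc r + d) r m (m+n≤o⇒n≤o N₀ (m+n≤o⇒m≤o _ N≤m)))
      where N≤m = +-cancelˡ-≤ d _ m N≤n

    absorb : ∀ U V w e A b p → 1 ≤ p → 1 ≤ w → U ≤ V * b + K * e → A * K * e ≤ b → A * U ≤ (V * A + p * w) * b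
    absorb U V w e A b p 1≤p 1≤w U≤ AKe≤b = begin
      A * U                      ≤⟨ *-monoʳ-≤ A U≤ ⟩
      A * (V * b + K * e)        ≡⟨ expand A V b K e ⟩
      V * A * b + A * K * e      ≤⟨ +-monoʳ-≤ (V * A * b) AKe≤b ⟩
      V * A * b + b              ≡⟨ cong (_+_ (V * A * b)) (*-identityˡ b) ⟨
      V * A * b + 1 * b          ≤⟨ +-monoʳ-≤ (V * A * b) (*-monoˡ-≤ b (*-mono-≤ 1≤p 1≤w)) ⟩
      V * A * b + p * w * b      ≡⟨ *-distribʳ-+ b (V * A) (p * w) ⟨
      (V * A + p * w) * b        ∎
      where
      open ≤-Reasoning
      expand : ∀ A V b K e → A * (V * b + K * e) ≡ V * A * b + A * K * e
      expand = solve-∀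

  -- Write ε = p / (a + 1) with p ≥ 1. Past the threshold K E ≤ B / (a + 1), so the error in the
  -- ratio is at most 1 / (a + 1) ≤ ε.
  density-≤ :
    (∀ m → N₀ ≤ m → (d + m) ≋ ℓ [mod k ] → suc u * maxδ k d ℓ (d + m) ≤ v * B m + K * E m) →
    ∀ ε → 0ℚ ℚ.< ε → ∃[ N ] (∀ n → N ≤ n → n ≋ ℓ [mod k ] → density k d ℓ n ℚ.≤ + v / suc u ℚ.+ ε)
  density-≤ bound (mkℚ (+ zero) _ _) (*<* (ℤ.+<+ ()))
  density-≤ bound ε@(mkℚ (+ suc p) a c) _ = threshold (suc a) , beyond (suc a) _ λ m N₀≤m 1≤B AKE≤B n≋ℓ →
    subst (ℚ._≤ + v / suc u ℚ.+ ε) (sym (density≡ m))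
      (ratio-≤ (maxδ k d ℓ (d + m)) (E m) (B m) 1≤B (bound m N₀≤m n≋ℓ) AKE≤B)
    where
    ratio-≤ : ∀ x e b → 1 ≤ b → suc u * x ≤ v * b + K * e → suc a * K * e ≤ b →
      ratio x b ℚ.≤ + v / suc u ℚ.+ mkℚ (+ suc p) a c
    ratio-≤ x e (suc b) _ le AKe≤b = /-≤-/+ x b v u (suc p) a c (≤-trans
      (≤-reflexive (rearrange x (suc u) (suc a)))
      (absorb (suc u * x) v (suc u) e (suc a) (suc b) (suc p) (s≤s z≤n) (s≤s z≤n) le AKe≤b))
      where
      rearrange : ∀ x u a → x * (u * a) ≡ a * (u * x)
      rearrange = solve-∀

  ≤-density :
    (∀ m → N₀ ≤ m → (d + m) ≋ ℓ [mod k ] → v * B m ≤ suc u * maxδ k d ℓ (d + m) + K * E m) →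
    ∀ ε → 0ℚ ℚ.< ε → ∃[ N ] (∀ n → N ≤ n → n ≋ ℓ [mod k ] → + v / suc u ℚ.≤ density k d ℓ n ℚ.+ ε)
  ≤-density bound (mkℚ (+ zero) _ _) (*<* (ℤ.+<+ ()))
  ≤-density bound ε@(mkℚ (+ suc p) a c) _ = threshold (suc a) , beyond (suc a) _ λ m N₀≤m 1≤B AKE≤B n≋ℓ →
    subst (λ q → + v / suc u ℚ.≤ q ℚ.+ ε) (sym (density≡ m))
      (≤-ratio (maxδ k d ℓ (d + m)) (E m) (B m) 1≤B (bound m N₀≤m n≋ℓ) AKE≤B)
    where
    ≤-ratio : ∀ x e b → 1 ≤ b → v * b ≤ suc u * x + K * e → suc a * K * e ≤ b →
      + v / suc u ℚ.≤ ratio x b ℚ.+ mkℚ (+ suc p) a c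
    ≤-ratio x e (suc b) _ le AKe≤b = /-≤-/+ v u x b (suc p) a c (begin
      v * (suc b * suc a)                          ≡⟨ rearrange v (suc b) (suc a) ⟩
      suc a * (v * suc b)                          ≤⟨ *-monoʳ-≤ (suc a) le ⟩
      suc a * (suc u * x + K * e)                  ≡⟨ expand (suc a) (suc u) x K e ⟩
      x * suc a * suc u + suc a * K * e            ≤⟨ +-monoʳ-≤ (x * suc a * suc u) AKe≤b ⟩
      x * suc a * suc u + suc b                    ≤⟨ +-monoʳ-≤ (x * suc a * suc u) (≤-trans (m≤n*m (suc b) (suc p)) (m≤m*n (suc p * suc b) (suc u))) ⟩
      x * suc a * suc u + suc p * suc b * suc u    ≡⟨ *-distribʳ-+ (suc u) (x * suc a) (suc p * suc b) ⟨
      (x * suc a + suc p * suc b) * suc u          ∎)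
      where
      open ≤-Reasoning
      rearrange : ∀ v b a → v * (b * a) ≡ a * (v * b)
      rearrange = solve-∀
      expand : ∀ a u x K e → a * (u * x + K * e) ≡ x * a * u + a * K * e
      expand = solve-∀

-- Comparing the limit with a rational

module _ {P : ℕ → Set} {a : ℕ → ℚ} {x : ℝ} (lim : LimitAlong P a x)
         (unbounded : ∀ N → ∃[ n ] (N ≤ n × P n)) where

  limit-≤ : ∀ q → (∀ ε → 0ℚ ℚ.< ε → ∃[ N ] (∀ n → N ≤ n → P n → a n ℚ.≤ q ℚ.+ ε)) → x ≤ᴿ fromℚ q
  limit-≤ q a≤ ε 0<ε =
    -- Of ε, a quarter goes to the distance between `a n` and `x`, a quarter to the approximations
    -- of `x`, and a half to the bound on `a n`.
    let h , 0<h , h+h≡ε = halve ε 0<ε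
        h′ , 0<h′ , h′+h′≡h = halve h 0<h
        N₁ , near = lim h′ 0<h′
        N₂ , below = a≤ h 0<h
        n , N≤n , Pn = unbounded (N₁ ⊔ N₂)
        N₃ , x≤ = proj₂ (near n (m⊔n≤o⇒m≤o N₁ N₂ N≤n) Pn) h′ 0<h′
    in N₃ , λ i N₃≤i → begin
      approx x i                ≤⟨ x≤ i N₃≤i ⟩
      a n ℚ.+ h′ ℚ.+ h′         ≡⟨ ℚ.+-assoc (a n) h′ h′ ⟩
      a n ℚ.+ (h′ ℚ.+ h′)       ≡⟨ cong (a n ℚ.+_) h′+h′≡h ⟩
      a n ℚ.+ h                 ≤⟨ ℚ.+-monoˡ-≤ h (below n (m⊔n≤o⇒n≤o N₁ N₂ N≤n) Pn) ⟩
      q ℚ.+ h ℚ.+ h             ≡⟨ ℚ.+-assoc q h h ⟩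
      q ℚ.+ (h ℚ.+ h)           ≡⟨ cong (q ℚ.+_) h+h≡ε ⟩
      q ℚ.+ ε                   ∎
    where open ℚ.≤-Reasoning

  ≤-limit : ∀ q → (∀ ε → 0ℚ ℚ.< ε → ∃[ N ] (∀ n → N ≤ n → P n → q ℚ.≤ a n ℚ.+ ε)) → fromℚ q ≤ᴿ x
  ≤-limit q ≤a ε 0<ε =
    let h , 0<h , h+h≡ε = halve ε 0<ε
        h′ , 0<h′ , h′+h′≡h = halve h 0<h
        N₁ , near = lim h′ 0<h′
        N₂ , below = ≤a h 0<h
        n , N≤n , Pn = unbounded (N₁ ⊔ N₂)
        N₃ , ≤x = proj₁ (near n (m⊔n≤o⇒m≤o N₁ N₂ N≤n) Pn) h′ 0<h′
    in N₃ , λ i N₃≤i → begin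
      q                                       ≤⟨ below n (m⊔n≤o⇒n≤o N₁ N₂ N≤n) Pn ⟩
      a n ℚ.+ h                               ≡⟨ cong (ℚ._+ h) (p-q+q≡p (a n) h′) ⟨
      a n ℚ.- h′ ℚ.+ h′ ℚ.+ h                 ≤⟨ ℚ.+-monoˡ-≤ h (ℚ.+-monoˡ-≤ h′ (≤x i N₃≤i)) ⟩
      approx x i ℚ.+ h′ ℚ.+ h′ ℚ.+ h          ≡⟨ cong (ℚ._+ h) (ℚ.+-assoc (approx x i) h′ h′) ⟩
      approx x i ℚ.+ (h′ ℚ.+ h′) ℚ.+ h        ≡⟨ cong (λ z → approx x i ℚ.+ z ℚ.+ h) h′+h′≡h ⟩
      approx x i ℚ.+ h ℚ.+ h                  ≡⟨ ℚ.+-assoc (approx x i) h h ⟩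
      approx x i ℚ.+ (h ℚ.+ h)                ≡⟨ cong (approx x i ℚ.+_) h+h≡ε ⟩
      approx x i ℚ.+ ε                        ∎
    where
    open ℚ.≤-Reasoning
    p-q+q≡p : ∀ p q → p ℚ.- q ℚ.+ q ≡ p
    p-q+q≡p p q = trans (ℚ.+-assoc p (ℚ.- q) q) (trans (cong (p ℚ.+_) (ℚ.+-inverseˡ q)) (ℚ.+-identityʳ p))

-- Half of the gap q - p absorbs the tolerance in x ≤ p; the other half remains as the uniform
-- separation that `_<ᴿ_` demands.
≤ᴿ-<-trans : ∀ {x p q} → x ≤ᴿ fromℚ p → p ℚ.< q → x <ᴿ fromℚ q
≤ᴿ-<-trans {x} {p} {q} x≤p p<q =
  let h , 0<h , h+h≡q-p = halve (q ℚ.- p) 0<q-p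
      N , x≤ = x≤p h 0<h
  in h , 0<h , N , λ n N≤n → begin
    approx x n ℚ.+ h      ≤⟨ ℚ.+-monoˡ-≤ h (x≤ n N≤n) ⟩
    p ℚ.+ h ℚ.+ h         ≡⟨ ℚ.+-assoc p h h ⟩
    p ℚ.+ (h ℚ.+ h)       ≡⟨ cong (p ℚ.+_) h+h≡q-p ⟩
    p ℚ.+ (q ℚ.- p)       ≡⟨ cong (p ℚ.+_) (ℚ.+-comm q (ℚ.- p)) ⟩
    p ℚ.+ (ℚ.- p ℚ.+ q)   ≡⟨ ℚ.+-assoc p (ℚ.- p) q ⟨
    p ℚ.- p ℚ.+ q         ≡⟨ cong (ℚ._+ q) (ℚ.+-inverseʳ p) ⟩
    0ℚ ℚ.+ q              ≡⟨ ℚ.+-identityˡ q ⟩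
    q                     ∎
  where
  open ℚ.≤-Reasoning
  0<q-p : 0ℚ ℚ.< q ℚ.- p
  0<q-p = subst (ℚ._< q ℚ.- p) (ℚ.+-inverseʳ p) (ℚ.+-monoˡ-< (ℚ.- p) p<q)

-- The bounds on g

≋-unbounded : ∀ k ℓ .{{_ : NonZero k}} N → ∃[ n ] (N ≤ n × n ≋ ℓ [mod k ])
≋-unbounded k ℓ N = ℓ + N * k , ≤-trans (m≤m*n N k) (m≤n+m (N * k) ℓ) , [m+kn]%n≡m%n ℓ N k

p/3[1+p]<1/3 : ∀ p u → suc u ≡ 3 * suc p → + p / suc u ℚ.< + 1 / 3
p/3[1+p]<1/3 p u u≡ = ℚ.toℚᵘ-cancel-< (ℚᵘ.<-respˡ-≃ (ℚᵘ.≃-sym (toℚᵘ-/ p u)) (ℚᵘ.<-respʳ-≃ (ℚᵘ.≃-sym (toℚᵘ-/ 1 2))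
  (ℚᵘ.*<* (subst₂ ℤ._<_ (ℤ.pos-* p 3) (ℤ.pos-* 1 (suc u)) (ℤ.+<+ (begin-strict
    p * 3        <⟨ *-monoˡ-< 3 (n<1+n p) ⟩
    suc p * 3    ≡⟨ *-comm (suc p) 3 ⟩
    3 * suc p    ≡⟨ u≡ ⟨
    suc u        ≡⟨ *-identityˡ (suc u) ⟨
    1 * suc u    ∎))))))
  where open ≤-Reasoning

/1*1/≡/ : ∀ x n p → .{{_ : NonZero n}} → n ≡ suc p → (+ x / 1) ℚ.* (+ 1 / n) ≡ + x / suc p
/1*1/≡/ x n p refl = ℚ.toℚᵘ-injective (begin
  toℚᵘ ((+ x / 1) ℚ.* (+ 1 / suc p))           ≈⟨ ℚ.toℚᵘ-homo-* (+ x / 1) (+ 1 / suc p) ⟩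
  toℚᵘ (+ x / 1) ℚᵘ.* toℚᵘ (+ 1 / suc p)       ≈⟨ ℚᵘ.*-cong (toℚᵘ-/ x 0) (toℚᵘ-/ 1 p) ⟩
  mkℚᵘ (+ x) 0 ℚᵘ.* mkℚᵘ (+ 1) p                   ≈⟨ ℚᵘ.*≡* (cong₂ ℤ._*_ (ℤ.*-identityʳ (+ x)) (cong +_ (sym (+-identityʳ (suc p))))) ⟩
  mkℚᵘ (+ x) p                                     ≈⟨ toℚᵘ-/ x p ⟨
  toℚᵘ (+ x / suc p)                             ∎)
  where
  open SetoidReasoning ℚᵘ.≃-setoid

module _ {k d ℓ : ℕ} .{{_ : NonZero k}} (r : ℕ) (k≡ : k ≡ d + suc r) (1≤d : 1 ≤ d) (ℓ<k : ℓ < k)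
         {g : ℝ} (lim : g[ k , d , ℓ ]≐ g) where

  g≤1/[1+e] : ∀ e → e ≤ d → e ≤ suc ℓ → g ≤ᴿ fromℚ (+ 1 / suc e)
  g≤1/[1+e] e e≤d e≤1+ℓ = limit-≤ {a = density k d ℓ} {x = g} lim (≋-unbounded k ℓ) (+ 1 / suc e)
    (density-≤ {k} {d} {ℓ} r k≡ e 1 (suc e * d + d) d λ m d≤m n≋ℓ →
      maxδ-average {k} {d} {ℓ} r m k≡ ℓ<k n≋ℓ e 1≤d d≤m e≤d e≤1+ℓ)

module _ {k d : ℕ} .{{_ : NonZero k}} (r p : ℕ) (k≡ : k ≡ d + suc r) (2^R≡ : 2 ^ suc r ≡ suc p) (2≤d : 2 ≤ d)
         {g : ℝ} (lim : g[ k , d , 1 ]≐ g) where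

  g<1/3 : g <ᴿ fromℚ (+ 1 / 3)
  g<1/3 = ≤ᴿ-<-trans {g} (limit-≤ {a = density k d 1} {x = g} lim (≋-unbounded k 1) (+ p / suc u)
    (density-≤ {k} {d} {1} r k≡ u p (suc u * d + p * (suc r + d)) d λ m d≤m n≋1 →
      maxδ-strict {k} {d} {1} r m k≡ 1<k n≋1 p u 2^R≡ refl refl 2≤d d≤m))
    (p/3[1+p]<1/3 p u refl)
    where
    -- Written so that `suc u` reduces to `3 * suc p`, that is 3 · 2^R.
    u = p + (suc p + (suc p + 0))
    1<k : 1 < k
    1<k = ≤-trans 2≤d (≤-trans (m≤m+n d (suc r)) (≤-reflexive (sym k≡)))

  private
    R : ℕ
    R = suc r

    -- A separate `P` lets `suc p` replace 2^R as the denominator while the floor of 2^R / 3 keeps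
    -- its form.
    half : ∀ P → 2 ^ R ≡ P → ∀ m → 2 * (d + 2) ≤ m →
      2 ^ R ℕ./ 3 * (m C R) ≤ P * maxδ k d 1 (d + m) + 2 ^ R ℕ./ 3 * (R + (2 * d + 5)) * ((R + d + m) C r)
    half P refl m large = maxδ-half {k} {d} r m k≡ (≤-trans large (m≤n+m m d))

    f/[1+p]≤g : ∀ f → (∀ m → 2 * (d + 2) ≤ m → f * (m C R) ≤ suc p * maxδ k d 1 (d + m) + f * (R + (2 * d + 5)) * ((R + d + m) C r)) →
      fromℚ (+ f / suc p) ≤ᴿ g
    f/[1+p]≤g f bound = ≤-limit {a = density k d 1} {x = g} lim (≋-unbounded k 1) (+ f / suc p)
      (≤-density {k} {d} {1} r k≡ p f (f * (R + (2 * d + 5))) (2 * (d + 2)) λ m large _ → bound m large)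

    fraction : ∀ R′ → R′ ≡ R → + (2 ^ R ℕ./ 3) / suc p ≡ + (2 ^ R′ ℕ./ 3) / 1 ℚ.* 2^- R′
    fraction R′ refl = sym (/1*1/≡/ (2 ^ R ℕ./ 3) (2 ^ R) p {{m^n≢0 2 R}} 2^R≡)

  ⌊2^r/3⌋2^-r≤g : fromℚ (+ (2 ^ (k ∸ d) ℕ./ 3) / 1 ℚ.* 2^- (k ∸ d)) ≤ᴿ g
  ⌊2^r/3⌋2^-r≤g = subst (λ q → fromℚ q ≤ᴿ g)
    (fraction (k ∸ d) (trans (cong (_∸ d) k≡) (m+n∸m≡n d R)))
    (f/[1+p]≤g (2 ^ R ℕ./ 3) (half (suc p) 2^R≡))

2^R≡suc : ∀ R → ∃[ p ] 2 ^ R ≡ suc p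
2^R≡suc R = pred (2 ^ R) , sym (suc-pred (2 ^ R) {{m^n≢0 2 R}})

proposition1p11 : ∀ (k d ℓ : ℕ) .{{_ : NonZero k}} → 1 ≤ d → d < k → ℓ < k →
    (∀ (g : ℝ) → g[ k , d , ℓ ]≐ g →
    (d ≤ ℓ + 1 → g ≤ᴿ fromℚ (+ 1 / (1 + d))) ×
    (ℓ + 1 ≤ d → g ≤ᴿ fromℚ (+ 1 / (2 + ℓ)))) ×
    (1 < d → ∀ (g : ℝ) → g[ k , d , 1 ]≐ g →
    fromℚ (+ (2 ^ (k ∸ d) ℕ./ 3) / 1 ℚ.* 2^- (k ∸ d)) ≤ᴿ g ×
    g <ᴿ fromℚ (+ 1 / 3))
proposition1p11 k d ℓ 1≤d d<k ℓ<k =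
  let r , 1+d+r≡k = m≤n⇒∃[o]m+o≡n d<k
      k≡ = trans (sym 1+d+r≡k) (sym (+-suc d r))
      p , 2^R≡ = 2^R≡suc (suc r)
  in (λ g lim →
       (λ d≤ℓ+1 → g≤1/[1+e] {k} {d} {ℓ} r k≡ 1≤d ℓ<k {g} lim d ≤-refl (≤-trans d≤ℓ+1 (≤-reflexive (+-comm ℓ 1)))) ,
       (λ ℓ+1≤d → g≤1/[1+e] {k} {d} {ℓ} r k≡ 1≤d ℓ<k {g} lim (suc ℓ) (≤-trans (≤-reflexive (+-comm 1 ℓ)) ℓ+1≤d) ≤-refl)) ,
     (λ 1<d g lim → ⌊2^r/3⌋2^-r≤g {k} {d} r p k≡ 2^R≡ 1<d {g} lim , g<1/3 {k} {d} r p k≡ 2^R≡ 1<d {g} lim)
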